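{- Let $R$ be a finite valuation ring of order $q^r$ and let $A$ be a nonempty subset of $R$. If $|A+A||A|^{2}>q^{3r-1}$, then $$|A^2+A^2||A+A|\gg q^{\frac{r}{2}}|A|^{\frac{3}{2}}.$$
   Context: A finite valuation ring is a finite commutative ring with identity that is local and principal (every ideal is principal). Saying that $R$ is a finite valuation ring of order $q^r$ means that the residue field of $R$ (the quotient by its maximal ideal) has $q$ elements, that $r\ge 1$ is the nilpotency index of the maximal ideal (the least $r$ such that its $r$-th power is zero), and hence $|R|=q^r$. For nonempty $X,Y\subset R$: $X+Y=\{x+y: x\in X, y\in Y\}$. Also $A^2=\{a^2: a\in A\}$ denotes the set of squares of elements of $A$ (not the product set $AA$). $X\ll Y$ means there is an absolute constant $c>0$ (independent of $R$, $q$, $r$ and all the sets involved) with $X\le cY$; $X\gg Y$ means $Y\ll X$.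
   Formalization: The formal theorem assumes that q is odd; without this the claim fails, e.g. for R the field with q=2^(10k) elements and A a subspace over the field of two elements of dimension 7k. -}

module Defs where

open import Level using (Level; _⊔_)
open import Algebra.Bundles using (CommutativeRing)
import Algebra.Properties.Group as GroupProperties
import Algebra.Properties.AbelianGroup as AbelianGroupProperties
import Algebra.Properties.Ring as RingProperties
open import Data.Bool using (true)
open import Data.Fin using (Fin; _≟_)
open import Data.Fin.Properties using (any?)
open import Data.Fin.Subset using (Subset; _∈_)
open import Data.Fin.Subset.Properties using (_∈?_)
open import Data.Nat using (ℕ; zero; suc; _≤_)
open import Data.Product using (∃; ∃-syntax; _×_; _,_; proj₁; proj₂)
open import Data.Unit.Polymorphic using (⊤)
open import Data.Vec using (tabulate)
open import Data.Vec.Properties using (lookup∘tabulate; []=⇒lookup; lookup⇒[]=)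
open import Function using (_∘_)
open import Function.Bundles using (Inverse; _⇔_; mk⇔)
open import Relation.Binary.Bundles using (Setoid)
open import Relation.Binary.PropositionalEquality as ≡ using (_≡_)
open import Relation.Nullary using (¬_; Dec; yes; no; does)
open import Relation.Nullary.Decidable using (_×-dec_; dec-true)
open import Relation.Unary using (Pred; Decidable)

private
  variable
    a b c ℓ : Level

HasCardinality : Setoid a b → ℕ → Set (a ⊔ b)
HasCardinality S n = Inverse (≡.setoid (Fin n)) S

record FiniteCommutativeRing (c ℓ : Level) : Set (Level.suc (c ⊔ ℓ)) where
  field
    commutativeRing : CommutativeRing c ℓ
    size            : ℕ
    enumeration     : HasCardinality (CommutativeRing.setoid commutativeRing) size

  open CommutativeRing commutativeRing public
  open Inverse enumeration public
    renaming (to to element; from to index)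
    using (to-cong; from-cong; inverseˡ; inverseʳ)

-- Every subset of the ring is represented by exactly one S : Subset size,
-- namely { element i ∣ i ∈ S }, so stdlib's ∣ S ∣ is its cardinality.
module _ (R : FiniteCommutativeRing c ℓ) where
  open FiniteCommutativeRing R

  infix 4 _∋_
  _∋_ : Subset size → Carrier → Set
  S ∋ x = index x ∈ S

  separate : {P : Pred (Fin size) a} → Decidable P → Subset size
  separate P? = tabulate (does ∘ P?)

  sumset : Subset size → Subset size → Subset size
  sumset A B = separate λ i → any? λ j → any? λ k →
    (j ∈? A) ×-dec (k ∈? B) ×-dec (i ≟ index (element j + element k))

  squares : Subset size → Subset size
  squares A = separate λ i → any? λ j →
    (j ∈? A) ×-dec (i ≟ index (element j * element j))

  record IsIdeal (I : Subset size) : Set c where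
    field
      0-closed : I ∋ 0#
      +-closed : ∀ {x y} → I ∋ x → I ∋ y → I ∋ x + y
      *-closed : ∀ r {x} → I ∋ x → I ∋ r * x

  IsPrincipal : Subset size → Set (c ⊔ ℓ)
  IsPrincipal I = ∃[ g ] ∀ x → (I ∋ x) ⇔ (∃[ r ] x ≈ r * g)

  record IsMaximal (M : Subset size) : Set c where
    field
      isIdeal : IsIdeal M
      proper  : ¬ (M ∋ 1#)
      maximal : ∀ N → IsIdeal N → ¬ (N ∋ 1#) →
                (∀ {x} → M ∋ x → N ∋ x) → (∀ {x} → N ∋ x → M ∋ x)

  -- The product of two ideals: all finite sums x₁ * y₁ + … + xₖ * yₖ.
  data _·_ (I : Pred Carrier a) (J : Pred Carrier b) :
           Pred Carrier (a ⊔ b ⊔ c ⊔ ℓ) where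
    empty : ∀ {z} → z ≈ 0# → (I · J) z
    cons  : ∀ {x y w z} → I x → J y → (I · J) w → z ≈ x * y + w → (I · J) z

  power : Subset size → ℕ → Pred Carrier (c ⊔ ℓ)
  power I zero    = λ _ → ⊤
  power I (suc k) = (I ∋_) · power I k

  IsZero : Pred Carrier a → Set (a ⊔ c ⊔ ℓ)
  IsZero I = ∀ {x} → I x → x ≈ 0#

  -- I ^ 0 is the whole ring, so r is automatically at least 1 when R is
  -- nontrivial.
  IsNilpotencyIndex : Subset size → ℕ → Set (c ⊔ ℓ)
  IsNilpotencyIndex I r = IsZero (power I r) × (∀ k → IsZero (power I k) → r ≤ k)

  module _ {I : Subset size} (isIdeal : IsIdeal I) where
    open IsIdeal isIdeal
    open RingProperties ring using (-1*x≈-x)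
    open GroupProperties +-group using (⁻¹-involutive)
    open AbelianGroupProperties +-abelianGroup using (⁻¹-∙-comm)

    private
      respects : ∀ {x y} → x ≈ y → I ∋ x → I ∋ y
      respects x≈y = ≡.subst (_∈ I) (from-cong x≈y)

      open import Relation.Binary.Reasoning.Setoid setoid

      swap : ∀ x y → - 1# * (x - y) ≈ y - x
      swap x y = begin
        - 1# * (x - y)  ≈⟨ -1*x≈-x (x - y) ⟩
        - (x - y)       ≈⟨ ⁻¹-∙-comm x (- y) ⟨
        - x + - - y     ≈⟨ +-congˡ (⁻¹-involutive y) ⟩
        - x + y         ≈⟨ +-comm (- x) y ⟩
        y - x           ∎

      telescope : ∀ x y z → (x - y) + (y - z) ≈ x - z
      telescope x y z = begin
        (x - y) + (y - z)    ≈⟨ +-assoc x (- y) (y - z) ⟩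
        x + (- y + (y - z))  ≈⟨ +-congˡ (+-assoc (- y) y (- z)) ⟨
        x + ((- y + y) - z)  ≈⟨ +-congˡ (+-congʳ (-‿inverseˡ y)) ⟩
        x + (0# - z)         ≈⟨ +-congˡ (+-identityˡ (- z)) ⟩
        x - z                ∎

    quotient : Setoid c Level.zero
    quotient = record
      { Carrier       = Carrier
      ; _≈_           = λ x y → I ∋ x - y
      ; isEquivalence = record
        { refl  = λ {x} → respects (sym (-‿inverseʳ x)) 0-closed
        ; sym   = λ {x} {y} p → respects (swap x y) (*-closed (- 1#) p)
        ; trans = λ {x} {y} {z} p q → respects (telescope x y z) (+-closed p q)
        }
      }

  -- "R is a finite valuation ring of order q ^ r"; that R has q ^ r elements
  -- is then a consequence and is not assumed.
  record IsValuationRing (q r : ℕ) : Set (c ⊔ ℓ) where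
    field
      𝔪                : Subset size
      𝔪-isMaximal      : IsMaximal 𝔪
      𝔪-unique         : ∀ N → IsMaximal N → N ≡ 𝔪
      principal        : ∀ I → IsIdeal I → IsPrincipal I
      residueField     : HasCardinality (quotient (IsMaximal.isIdeal 𝔪-isMaximal)) q
      nilpotencyIndex  : IsNilpotencyIndex 𝔪 r

  private
    ∈-separate : {P : Pred (Fin size) a} (P? : Decidable P) →
                 ∀ i → (i ∈ separate P?) ⇔ P i
    ∈-separate {P = P} P? i = mk⇔ (λ p → extract (P? i) (lemma p))
      (λ p → lookup⇒[]= i _ (≡.trans (lookup∘tabulate (does ∘ P?) i) (dec-true (P? i) p)))
      where
      lemma : i ∈ separate P? → does (P? i) ≡ true
      lemma p = ≡.trans (≡.sym (lookup∘tabulate (does ∘ P?) i)) ([]=⇒lookup p)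

      extract : (d : Dec (P i)) → does d ≡ true → P i
      extract (yes p) _ = p
      extract (no _) ()

    index-element : ∀ i → index (element i) ≡ i
    index-element i = inverseʳ refl

    element-index : ∀ x → element (index x) ≈ x
    element-index x = inverseˡ ≡.refl

    index-injective : ∀ {x y} → index x ≡ index y → x ≈ y
    index-injective {x} {y} p =
      trans (sym (element-index x)) (trans (to-cong p) (element-index y))

    ∋-element : ∀ {A i} → i ∈ A → A ∋ element i
    ∋-element {A} {i} = ≡.subst (_∈ A) (≡.sym (index-element i))

  ∋-sumset : ∀ A B z →
             (sumset A B ∋ z) ⇔ (∃[ x ] ∃[ y ] A ∋ x × B ∋ y × z ≈ x + y)
  ∋-sumset A B z = mk⇔ to from
    where
    open Function.Bundles.Equivalence (∈-separate (λ i → any? λ j → any? λ k →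
      (j ∈? A) ×-dec (k ∈? B) ×-dec (i ≟ index (element j + element k))) (index z))
      renaming (to to ⇒; from to ⇐) using ()

    to : sumset A B ∋ z → ∃[ x ] ∃[ y ] A ∋ x × B ∋ y × z ≈ x + y
    to p with j , k , j∈A , k∈B , eq ← ⇒ p =
      element j , element k , ∋-element j∈A , ∋-element k∈B , index-injective eq

    from : (∃[ x ] ∃[ y ] A ∋ x × B ∋ y × z ≈ x + y) → sumset A B ∋ z
    from (x , y , x∈A , y∈B , eq) = ⇐ (index x , index y , x∈A , y∈B ,
      from-cong (trans eq (sym (+-cong (element-index x) (element-index y)))))

  ∋-squares : ∀ A z → (squares A ∋ z) ⇔ (∃[ x ] A ∋ x × z ≈ x * x)
  ∋-squares A z = mk⇔ to from
    where
    open Function.Bundles.Equivalence (∈-separate (λ i → any? λ j →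
      (j ∈? A) ×-dec (i ≟ index (element j * element j))) (index z))
      renaming (to to ⇒; from to ⇐) using ()

    to : squares A ∋ z → ∃[ x ] A ∋ x × z ≈ x * x
    to p with j , j∈A , eq ← ⇒ p = element j , ∋-element j∈A , index-injective eq

    from : (∃[ x ] A ∋ x × z ≈ x * x) → squares A ∋ z
    from (x , x∈A , eq) = ⇐ (index x , x∈A ,
      from-cong (trans eq (sym (*-cong (element-index x) (element-index x)))))

-- For (x , y) ∈ R × R let u (x , y) be the number of pairs (a , s) ∈ A × A² for
-- which the parabola y = (x − a)² + s passes through (x , y).  Every a, c ∈ A
-- and s ∈ A² give an incidence at the point (a + c , c² + s) of
-- (A + A) × (A² + A²).  Since 2 is a unit, two parabolas with a − a′ outside the
-- maximal ideal 𝔪 meet in at most one point; this bounds the second moment of u.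
-- Write Q = qʳ, M = |𝔪| = Q / q, N = |A|, T = |A²| and W = |A + A| |A² + A²|.
-- Chebyshev's inequality gives Q N ≪ W, which suffices, or N³ T ≪ W Q M.
-- Units have at most two square roots and the hypothesis makes A larger than 𝔪,
-- so T ≫ N and thus N⁴ ≪ W Q M in the second case.  This suffices if
-- N⁵ q² ≥ Q⁵; otherwise |A + A| N² > Q³ / q makes the trivial bound
-- W ≥ |A + A| T ≫ |A + A| N sufficient.
module Submission where

open import Defs
open import Level using (Level)
open import Data.Nat using (ℕ; _+_; _*_; _∸_; _^_; _≤_; _<_; _>_)
open import Data.Nat.Divisibility using (_∣_)
open import Data.Fin.Subset using (Subset; Nonempty; ∣_∣)
open import Data.Product using (∃-syntax; _×_)
open import Relation.Nullary using (¬_)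

open import Algebra.Bundles using (AbelianGroup; CommutativeRing; RawRing)
open import Algebra.Core using (Op₁; Op₂)
open import Algebra.Morphism.Structures using (IsRingMonomorphism)
import Algebra.Morphism.RingMonomorphism as RingMonomorphism
import Algebra.Properties.Group as GroupProperties
open import Algebra.Structures using (IsAbelianGroup; IsCommutativeRing)
open import Data.Bool using (if_then_else_)
import Data.Fin as Fin
open import Data.Fin using (Fin; zero; suc; remQuot; combine)
open import Data.Fin.Permutation using (permutation)
open import Data.Fin.Properties
  using (any?; _≟_; _<?_; <-cmp; combine-remQuot; remQuot-combine; injective⇒≤)
open import Data.Fin.Subset using (_∈_; _∉_; inside; outside)
open import Data.Fin.Subset.Properties using (_∈?_; ∣p∣≤n)
open import Data.List using ([]; _∷_)
open import Data.Nat using (zero; suc; z≤n; s≤s; z<s; NonZero; >-nonZero; >-nonZero⁻¹)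
open import Data.Nat.Divisibility using (divides; ∣-refl)
open import Data.Nat.Properties hiding (_≟_; _<?_; <-cmp)
open import Data.Nat.Tactic.RingSolver using (solve-∀) renaming (solve to ℕ-solve)
open import Data.Product using (_,_; proj₁; proj₂)
open import Data.Sum using (_⊎_; inj₁; inj₂)
open import Data.Unit.Polymorphic using (tt)
open import Data.Vec as Vec using (tabulate)
open import Data.Vec.Properties using (lookup∘tabulate; []=⇒lookup; lookup⇒[]=)
open import Function using (_∘_; const; it; Injective)
open import Function.Bundles using (Inverse; Equivalence)
open import Relation.Binary using (Setoid; Tri; tri<; tri≈; tri>)
open import Relation.Binary.PropositionalEquality
  using (_≡_; _≢_; refl; sym; trans; cong; cong₂; subst; module ≡-Reasoning)
open import Relation.Nullary using (Dec; yes; no; does; ¬?; contradiction; _×-dec_)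
open import Relation.Nullary.Decidable using (dec-true)
open import Relation.Unary using (Pred; Decidable)

open import Algebra.Properties.Semiring.Sum +-*-semiring
  using (sum-syntax; sum-cong-≗; ∑-comm; ∑-permute; ∑-distrib-+; *-distribˡ-sum; *-distribʳ-sum)

private
  variable
    a ℓ ℓ′ : Level
    m n : ℕ
    P P′ P″ : Set a

-- Indicator functions and finite sums.

⟦_⟧ : Dec P → ℕ
⟦ d ⟧ = if does d then 1 else 0

𝟙 : Subset n → Fin n → ℕ
𝟙 p i = ⟦ i ∈? p ⟧

⟦⟧-yes : (d : Dec P) → P → ⟦ d ⟧ ≡ 1
⟦⟧-yes (yes _) _ = refl
⟦⟧-yes (no ¬p) p = contradiction p ¬p

⟦⟧-no : (d : Dec P) → ¬ P → ⟦ d ⟧ ≡ 0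
⟦⟧-no (yes p) ¬p = contradiction p ¬p
⟦⟧-no (no _)  _  = refl

⟦⟧≤1 : (d : Dec P) → ⟦ d ⟧ ≤ 1
⟦⟧≤1 (yes _) = ≤-refl
⟦⟧≤1 (no _)  = z≤n

⟦⟧-mono : (d : Dec P) (e : Dec P′) → (P → P′) → ⟦ d ⟧ ≤ ⟦ e ⟧
⟦⟧-mono (no _)  _       _ = z≤n
⟦⟧-mono (yes _) (yes _) _ = ≤-refl
⟦⟧-mono (yes p) (no ¬q) f = contradiction (f p) ¬q

⟦⟧-idem : (d : Dec P) → ⟦ d ⟧ * ⟦ d ⟧ ≡ ⟦ d ⟧
⟦⟧-idem (yes _) = refl
⟦⟧-idem (no _)  = refl

⟦⟧-*-mono : (d : Dec P) (e : Dec P′) (d′ : Dec P″) → (P → P′ → P″) →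
            ⟦ d ⟧ * ⟦ e ⟧ ≤ ⟦ d′ ⟧
⟦⟧-*-mono (no _)  _       _        _ = z≤n
⟦⟧-*-mono (yes _) (no _)  _        _ = z≤n
⟦⟧-*-mono (yes _) (yes _) (yes _)  _ = ≤-refl
⟦⟧-*-mono (yes p) (yes q) (no ¬p′) f = contradiction (f p q) ¬p′

∑-mono : {f g : Fin n → ℕ} → (∀ i → f i ≤ g i) → ∑[ i < n ] f i ≤ ∑[ i < n ] g i
∑-mono {zero}  f≤g = z≤n
∑-mono {suc n} f≤g = +-mono-≤ (f≤g zero) (∑-mono (f≤g ∘ suc))

∑-const : ∀ n c → ∑[ i < n ] c ≡ n * c
∑-const zero    c = refl
∑-const (suc n) c = cong (c +_) (∑-const n c)

∑-*ˡ : ∀ c (f : Fin n → ℕ) → ∑[ i < n ] (c * f i) ≡ c * ∑[ i < n ] f i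
∑-*ˡ c f = sym (*-distribˡ-sum c f)

∑-*ʳ : ∀ c (f : Fin n → ℕ) → ∑[ i < n ] (f i * c) ≡ (∑[ i < n ] f i) * c
∑-*ʳ c f = sym (*-distribʳ-sum c f)

∑-*-∑ : (f : Fin m → ℕ) (g : Fin n → ℕ) →
        (∑[ i < m ] f i) * (∑[ j < n ] g j) ≡ ∑[ i < m ] ∑[ j < n ] (f i * g j)
∑-*-∑ f g = trans (*-distribʳ-sum _ f) (sum-cong-≗ λ i → *-distribˡ-sum (f i) g)

term≤∑ : (f : Fin n → ℕ) (i : Fin n) → f i ≤ ∑[ i < n ] f i
term≤∑ f zero    = m≤m+n (f zero) _
term≤∑ f (suc i) = ≤-trans (term≤∑ (f ∘ suc) i) (m≤n+m _ (f zero))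

∑-≤-const : ∀ {c} {f : Fin n → ℕ} → (∀ i → f i ≤ c) → ∑[ i < n ] f i ≤ n * c
∑-≤-const {n} {c} f≤c = ≤-trans (∑-mono f≤c) (≤-reflexive (∑-const n c))

∑-zero : {f : Fin n → ℕ} → (∀ i → f i ≡ 0) → ∑[ i < n ] f i ≡ 0
∑-zero {n} f≡0 = trans (sum-cong-≗ f≡0) (trans (∑-const n 0) (*-zeroʳ n))

∣p∣≡∑𝟙 : (p : Subset n) → ∣ p ∣ ≡ ∑[ i < n ] 𝟙 p i
∣p∣≡∑𝟙 Vec.[]            = refl
∣p∣≡∑𝟙 (inside  Vec.∷ p) = cong suc (∣p∣≡∑𝟙 p)
∣p∣≡∑𝟙 (outside Vec.∷ p) = ∣p∣≡∑𝟙 p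

∑-δ : (f : Fin n → ℕ) (k : Fin n) → ∑[ i < n ] (⟦ k ≟ i ⟧ * f i) ≡ f k
∑-δ f zero    = trans
  (cong₂ _+_ (*-identityˡ (f zero)) (∑-zero {f = λ i → 0 * f (suc i)} λ _ → refl))
  (+-identityʳ (f zero))
∑-δ f (suc k) = ∑-δ (f ∘ suc) k

∑-⟦≟⟧ : (k : Fin n) → ∑[ i < n ] ⟦ k ≟ i ⟧ ≡ 1
∑-⟦≟⟧ k = trans (sum-cong-≗ λ i → sym (*-identityʳ ⟦ k ≟ i ⟧)) (∑-δ (const 1) k)

-- Either there is no solution and the sum vanishes, or the k candidates computed from one solution
-- `i₀` cover all the others.
∑-⟦⟧-≤ : ∀ k {P : Fin n → Set a} (P? : ∀ i → Dec (P i)) (c : Fin n → Fin k → Fin n) →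
         (∀ {i j} → P i → P j → ∃[ l ] c i l ≡ j) → ∑[ i < n ] ⟦ P? i ⟧ ≤ k
∑-⟦⟧-≤ {n = n} k {P} P? c candidate with any? P?
... | no none = ≤-trans (≤-reflexive (∑-zero λ i → ⟦⟧-no (P? i) λ p → none (i , p))) z≤n
... | yes (i₀ , p₀) = begin
  ∑[ i < n ] ⟦ P? i ⟧                    ≤⟨ ∑-mono (λ i → lemma (P? i)) ⟩
  ∑[ i < n ] ∑[ l < k ] ⟦ c i₀ l ≟ i ⟧   ≡⟨ ∑-comm (λ i l → ⟦ c i₀ l ≟ i ⟧) ⟩
  ∑[ l < k ] ∑[ i < n ] ⟦ c i₀ l ≟ i ⟧   ≡⟨ sum-cong-≗ (λ l → ∑-⟦≟⟧ (c i₀ l)) ⟩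
  ∑[ l < k ] 1                           ≡⟨ trans (∑-const k 1) (*-identityʳ k) ⟩
  k                                      ∎
  where
  open ≤-Reasoning
  lemma : ∀ {i} (d : Dec (P i)) → ⟦ d ⟧ ≤ ∑[ l < k ] ⟦ c i₀ l ≟ i ⟧
  lemma     (no _)  = z≤n
  lemma {i} (yes p) with l , eq ← candidate p₀ p = begin
    1                          ≡⟨ ⟦⟧-yes (c i₀ l ≟ i) eq ⟨
    ⟦ c i₀ l ≟ i ⟧             ≤⟨ term≤∑ (λ l → ⟦ c i₀ l ≟ i ⟧) l ⟩
    ∑[ l < k ] ⟦ c i₀ l ≟ i ⟧  ∎

-- Group the left-hand sum by the value of `φ`: writing `f (φ i)` as a sum over j of
-- `⟦ φ i ≟ j ⟧ * f j` and exchanging the sums leaves the weight of each fibre as the coefficient of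
-- `f j`.
∑-fibres : ∀ {k} (u : Fin m → ℕ) (φ : Fin m → Fin n) (f : Fin n → ℕ) →
           (∀ j → ∑[ i < m ] (u i * ⟦ φ i ≟ j ⟧) ≤ k) →
           ∑[ i < m ] (u i * f (φ i)) ≤ k * ∑[ j < n ] f j
∑-fibres {m} {n} {k} u φ f fibre≤k = begin
  ∑[ i < m ] (u i * f (φ i))
    ≡⟨ sum-cong-≗ (λ i → cong (u i *_) (∑-δ f (φ i))) ⟨
  ∑[ i < m ] (u i * ∑[ j < n ] (⟦ φ i ≟ j ⟧ * f j))
    ≡⟨ sum-cong-≗ (λ i → *-distribˡ-sum (u i) (λ j → ⟦ φ i ≟ j ⟧ * f j)) ⟩
  ∑[ i < m ] ∑[ j < n ] (u i * (⟦ φ i ≟ j ⟧ * f j))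
    ≡⟨ ∑-comm (λ i j → u i * (⟦ φ i ≟ j ⟧ * f j)) ⟩
  ∑[ j < n ] ∑[ i < m ] (u i * (⟦ φ i ≟ j ⟧ * f j))
    ≡⟨ sum-cong-≗ (λ j → sum-cong-≗ λ i → sym (*-assoc (u i) _ (f j))) ⟩
  ∑[ j < n ] ∑[ i < m ] (u i * ⟦ φ i ≟ j ⟧ * f j)
    ≡⟨ sum-cong-≗ (λ j → ∑-*ʳ (f j) (λ i → u i * ⟦ φ i ≟ j ⟧)) ⟩
  ∑[ j < n ] (∑[ i < m ] (u i * ⟦ φ i ≟ j ⟧) * f j)
    ≤⟨ ∑-mono (λ j → *-monoˡ-≤ (f j) (fibre≤k j)) ⟩
  ∑[ j < n ] (k * f j)
    ≡⟨ ∑-*ˡ k f ⟩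
  k * ∑[ j < n ] f j ∎
  where open ≤-Reasoning

∑-injective : (φ : Fin m → Fin n) (f : Fin n → ℕ) → Injective _≡_ _≡_ φ →
              ∑[ i < m ] f (φ i) ≤ ∑[ j < n ] f j
∑-injective {m} {n} φ f inj = begin
  ∑[ i < m ] f (φ i)        ≡⟨ sum-cong-≗ (λ i → sym (*-identityˡ (f (φ i)))) ⟩
  ∑[ i < m ] (1 * f (φ i))  ≤⟨ ∑-fibres (const 1) φ f fibre≤1 ⟩
  1 * ∑[ j < n ] f j        ≡⟨ *-identityˡ _ ⟩
  ∑[ j < n ] f j            ∎
  where
  open ≤-Reasoning
  fibre≤1 : ∀ j → ∑[ i < m ] (1 * ⟦ φ i ≟ j ⟧) ≤ 1
  fibre≤1 j = ≤-trans (≤-reflexive (sum-cong-≗ λ i → *-identityˡ ⟦ φ i ≟ j ⟧))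
    (∑-⟦⟧-≤ 1 (λ i → φ i ≟ j) const λ p q → zero , inj (trans p (sym q)))

∑-bijective : (φ ψ : Fin n → Fin n) (f : Fin n → ℕ) →
              (∀ i → φ (ψ i) ≡ i) → (∀ i → ψ (φ i) ≡ i) →
              ∑[ i < n ] f (φ i) ≡ ∑[ i < n ] f i
∑-bijective {n} φ ψ f φψ ψφ = sym (∑-permute f (permutation φ ψ φψ ψφ))

-- Every i satisfies exactly one of `i < σ i` and `σ i < i`, and reindexing by `σ` shows that both
-- cases occur equally often.
fixedPointFree-involution⇒2∣ : (σ : Fin n → Fin n) → (∀ i → σ (σ i) ≡ i) →
                               (∀ i → σ i ≢ i) → 2 ∣ n
fixedPointFree-involution⇒2∣ {n} σ σσ free = divides (∑[ i < n ] ⟦ i <? σ i ⟧) (begin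
  n
    ≡⟨ *-identityʳ n ⟨
  n * 1
    ≡⟨ ∑-const n 1 ⟨
  ∑[ i < n ] 1
    ≡⟨ sum-cong-≗ (λ i → lemma (<-cmp i (σ i))) ⟩
  ∑[ i < n ] (⟦ i <? σ i ⟧ + ⟦ σ i <? i ⟧)
    ≡⟨ ∑-distrib-+ (λ i → ⟦ i <? σ i ⟧) _ ⟩
  up + (∑[ i < n ] ⟦ σ i <? i ⟧)
    ≡⟨ cong (up +_) (sum-cong-≗ λ i → cong (λ j → ⟦ σ i <? j ⟧) (sym (σσ i))) ⟩
  up + (∑[ i < n ] ⟦ σ i <? σ (σ i) ⟧)
    ≡⟨ cong (up +_) (∑-bijective σ σ (λ i → ⟦ i <? σ i ⟧) σσ σσ) ⟩
  up + up
    ≡⟨ cong (up +_) (+-identityʳ up) ⟨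
  2 * up
    ≡⟨ *-comm 2 up ⟩
  up * 2 ∎)
  where
  open ≡-Reasoning
  up = ∑[ i < n ] ⟦ i <? σ i ⟧
  lemma : ∀ {i} → Tri (i Fin.< σ i) (i ≡ σ i) (σ i Fin.< i) → 1 ≡ ⟦ i <? σ i ⟧ + ⟦ σ i <? i ⟧
  lemma {i} (tri< lt _ ≯) = sym (cong₂ _+_ (⟦⟧-yes (i <? σ i) lt) (⟦⟧-no (σ i <? i) ≯))
  lemma {i} (tri≈ _ eq _) = contradiction (sym eq) (free i)
  lemma {i} (tri> ≮ _ gt) = sym (cong₂ _+_ (⟦⟧-no (i <? σ i) ≮) (⟦⟧-yes (σ i <? i) gt))

-- Second moments.

2ab≤a²+b² : ∀ a b → 2 * (a * b) ≤ a * a + b * b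
2ab≤a²+b² a b with ≤-total a b
... | inj₁ a≤b with k , refl ← m≤n⇒∃[o]m+o≡n a≤b = begin
  2 * (a * (a + k))                ≤⟨ m≤m+n _ (k * k) ⟩
  2 * (a * (a + k)) + k * k        ≡⟨ ℕ-solve (a ∷ k ∷ []) ⟩
  a * a + (a + k) * (a + k)        ∎
  where open ≤-Reasoning
... | inj₂ b≤a with k , refl ← m≤n⇒∃[o]m+o≡n b≤a = begin
  2 * ((b + k) * b)                ≤⟨ m≤m+n _ (k * k) ⟩
  2 * ((b + k) * b) + k * k        ≡⟨ ℕ-solve (b ∷ k ∷ []) ⟩
  (b + k) * (b + k) + b * b        ∎
  where open ≤-Reasoning

-- Used twice in succession, for the inner and the outer sum, this lifts a pointwise inequality with
-- fixed coefficients to double sums.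
∑-linear-≤ : ∀ α β γ δ ε (f g h k l : Fin n → ℕ) →
             (∀ i → α * f i + β * g i ≤ γ * h i + δ * k i + ε * l i) →
             α * (∑[ i < n ] f i) + β * (∑[ i < n ] g i) ≤
             γ * (∑[ i < n ] h i) + δ * (∑[ i < n ] k i) + ε * (∑[ i < n ] l i)
∑-linear-≤ {n} α β γ δ ε f g h k l f≤ = begin
  α * (∑[ i < n ] f i) + β * (∑[ i < n ] g i)
    ≡⟨ cong₂ _+_ (∑-*ˡ α f) (∑-*ˡ β g) ⟨
  (∑[ i < n ] (α * f i)) + (∑[ i < n ] (β * g i))
    ≡⟨ ∑-distrib-+ (λ i → α * f i) _ ⟨
  ∑[ i < n ] (α * f i + β * g i)
    ≤⟨ ∑-mono f≤ ⟩
  ∑[ i < n ] (γ * h i + δ * k i + ε * l i)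
    ≡⟨ trans (∑-distrib-+ (λ i → γ * h i + δ * k i) _) (cong (_+ _) (∑-distrib-+ (λ i → γ * h i) _)) ⟩
  (∑[ i < n ] (γ * h i)) + (∑[ i < n ] (δ * k i)) + (∑[ i < n ] (ε * l i))
    ≡⟨ cong₂ _+_ (cong₂ _+_ (∑-*ˡ γ h) (∑-*ˡ δ k)) (∑-*ˡ ε l) ⟩
  γ * (∑[ i < n ] h i) + δ * (∑[ i < n ] k i) + ε * (∑[ i < n ] l i) ∎
  where open ≤-Reasoning

-- This is 0 ≤ (w u - v - p l)² with the negative terms moved to the left; idempotence of p makes
-- the square of p l linear in p.
weighted-2ab≤a²+b² : ∀ w v l u p → p * p ≡ p →
  2 * w * v * u + 2 * w * l * (p * u) ≤
  w * w * (u * u) + v * v * 1 + (2 * v * l + l * l) * p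
weighted-2ab≤a²+b² w v l u p pp≡p = begin
  2 * w * v * u + 2 * w * l * (p * u)
    ≡⟨ ℕ-solve (w ∷ v ∷ l ∷ u ∷ p ∷ []) ⟩
  2 * ((w * u) * (v + p * l))
    ≤⟨ 2ab≤a²+b² (w * u) (v + p * l) ⟩
  (w * u) * (w * u) + (v + p * l) * (v + p * l)
    ≡⟨ ℕ-solve (w ∷ v ∷ l ∷ u ∷ p ∷ []) ⟩
  w * w * (u * u) + v * v * 1 + (2 * v * l * p + l * l * (p * p))
    ≡⟨ cong (λ x → w * w * (u * u) + v * v * 1 + (2 * v * l * p + l * l * x)) pp≡p ⟩
  w * w * (u * u) + v * v * 1 + (2 * v * l * p + l * l * p)
    ≡⟨ ℕ-solve (w ∷ v ∷ l ∷ u ∷ p ∷ []) ⟩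
  w * w * (u * u) + v * v * 1 + (2 * v * l + l * l) * p ∎
  where open ≤-Reasoning

∑∑-weighted-2ab≤a²+b² : ∀ w v l (u p : Fin n → Fin n → ℕ) → (∀ i j → p i j * p i j ≡ p i j) →
  2 * w * v * (∑[ i < n ] ∑[ j < n ] u i j) + 2 * w * l * (∑[ i < n ] ∑[ j < n ] (p i j * u i j)) ≤
  w * w * (∑[ i < n ] ∑[ j < n ] (u i j * u i j)) + v * v * (n * n) +
    (2 * v * l + l * l) * (∑[ i < n ] ∑[ j < n ] p i j)
∑∑-weighted-2ab≤a²+b² {n} w v l u p pp≡p = begin
  α * (∑[ i < n ] ∑[ j < n ] u i j) + β * (∑[ i < n ] ∑[ j < n ] (p i j * u i j))
    ≤⟨ ∑-linear-≤ α β γ δ ε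
         (λ i → ∑[ j < n ] u i j) (λ i → ∑[ j < n ] (p i j * u i j))
         (λ i → ∑[ j < n ] (u i j * u i j)) (λ i → ∑[ j < n ] 1) (λ i → ∑[ j < n ] p i j)
         (λ i → ∑-linear-≤ α β γ δ ε
           (u i) (λ j → p i j * u i j) (λ j → u i j * u i j) (const 1) (p i)
           λ j → weighted-2ab≤a²+b² w v l (u i j) (p i j) (pp≡p i j)) ⟩
  γ * (∑[ i < n ] ∑[ j < n ] (u i j * u i j)) + δ * (∑[ i < n ] ∑[ j < n ] 1) +
    ε * (∑[ i < n ] ∑[ j < n ] p i j)
    ≡⟨ cong (λ x → γ * (∑[ i < n ] ∑[ j < n ] (u i j * u i j)) + δ * x +
         ε * (∑[ i < n ] ∑[ j < n ] p i j)) ∑∑1 ⟩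
  γ * (∑[ i < n ] ∑[ j < n ] (u i j * u i j)) + δ * (n * n) + ε * (∑[ i < n ] ∑[ j < n ] p i j) ∎
  where
  open ≤-Reasoning
  α = 2 * w * v
  β = 2 * w * l
  γ = w * w
  δ = v * v
  ε = 2 * v * l + l * l
  ∑∑1 : ∑[ i < n ] ∑[ j < n ] 1 ≡ n * n
  ∑∑1 = trans (sum-cong-≗ {n} λ _ → trans (∑-const n 1) (*-identityʳ n)) (∑-const n n)

-- Chebyshev's inequality for the deviation of u from its mean D / n on the
-- set p: the inequality 0 ≤ (n W u − W D − p n N D)² is summed over all
-- (i , j), with both sides moved so that no subtraction occurs.
concentration : (u p : Fin n → Fin n → ℕ) (N D W M : ℕ)
  .{{_ : NonZero n}} .{{_ : NonZero D}} .{{_ : NonZero W}} →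
  (∀ i j → p i j * p i j ≡ p i j) →
  ∑[ i < n ] ∑[ j < n ] p i j ≡ W →
  ∑[ i < n ] ∑[ j < n ] u i j ≡ n * D →
  ∑[ i < n ] ∑[ j < n ] (u i j * u i j) ≤ D * D + D * (n * M) →
  N * D ≤ ∑[ i < n ] ∑[ j < n ] (p i j * u i j) →
  n * (N * N) * D ≤ W * (n * n) * M + 2 * W * N * D
concentration {n} u p N D W M pp≡p ∑p ∑u ∑u² ∑pu =
  *-cancelˡ-≤ (n * D) {{m*n≢0 n D}}
  (*-cancelˡ-≤ W (+-cancelˡ-≤ (2 * (W * W * (n * n) * (D * D)) + W * ((n * N * D) * (n * N * D))) _ _ (begin
    2 * (W * W * (n * n) * (D * D)) + W * ((n * N * D) * (n * N * D)) + W * (n * D * (n * (N * N) * D))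
      ≡⟨ ℕ-solve (W ∷ n ∷ D ∷ N ∷ []) ⟩
    2 * (W * n) * (W * D) * (n * D) + 2 * (W * n) * (n * N * D) * (N * D)
      ≤⟨ +-mono-≤ (≤-reflexive (cong (2 * (W * n) * (W * D) *_) (sym ∑u)))
           (*-monoʳ-≤ (2 * (W * n) * (n * N * D)) ∑pu) ⟩
    2 * (W * n) * (W * D) * (∑[ i < n ] ∑[ j < n ] u i j) +
      2 * (W * n) * (n * N * D) * (∑[ i < n ] ∑[ j < n ] (p i j * u i j))
      ≤⟨ ∑∑-weighted-2ab≤a²+b² (W * n) (W * D) (n * N * D) u p pp≡p ⟩
    (W * n) * (W * n) * (∑[ i < n ] ∑[ j < n ] (u i j * u i j)) + (W * D) * (W * D) * (n * n) +
      (2 * (W * D) * (n * N * D) + (n * N * D) * (n * N * D)) * (∑[ i < n ] ∑[ j < n ] p i j)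
      ≤⟨ +-mono-≤ (+-monoˡ-≤ _ (*-monoʳ-≤ ((W * n) * (W * n)) ∑u²))
           (≤-reflexive (cong ((2 * (W * D) * (n * N * D) + (n * N * D) * (n * N * D)) *_) ∑p)) ⟩
    (W * n) * (W * n) * (D * D + D * (n * M)) + (W * D) * (W * D) * (n * n) +
      (2 * (W * D) * (n * N * D) + (n * N * D) * (n * N * D)) * W
      ≡⟨ ℕ-solve (W ∷ n ∷ D ∷ N ∷ M ∷ []) ⟩
    2 * (W * W * (n * n) * (D * D)) + W * ((n * N * D) * (n * N * D)) +
      W * (n * D * (W * (n * n) * M + 2 * W * N * D)) ∎)))
  where open ≤-Reasoning

-- Incidences between points and translated curves.

module Incidences {n : ℕ} {_⊕_ : Op₂ (Fin n)} {𝟘 : Fin n} {⊖_ : Op₁ (Fin n)}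
                  (isAbelianGroup : IsAbelianGroup _≡_ _⊕_ 𝟘 ⊖_) where

  private
    group : AbelianGroup _ _
    group = record { isAbelianGroup = isAbelianGroup }
  open AbelianGroup group using (assoc; identityʳ; inverseˡ; inverseʳ; comm)

  ⊕-⊖-cancel : ∀ x c → (x ⊕ c) ⊕ (⊖ c) ≡ x
  ⊕-⊖-cancel x c = trans (assoc x c _) (trans (cong (x ⊕_) (inverseʳ c)) (identityʳ x))

  ⊖-⊕-cancel : ∀ x c → (x ⊕ (⊖ c)) ⊕ c ≡ x
  ⊖-⊕-cancel x c = trans (assoc x _ c) (trans (cong (x ⊕_) (inverseˡ c)) (identityʳ x))

  ∑-translate : ∀ c (f : Fin n → ℕ) → ∑[ x < n ] f (x ⊕ c) ≡ ∑[ x < n ] f x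
  ∑-translate c f = ∑-bijective (_⊕ c) (_⊕ (⊖ c)) f (λ x → ⊖-⊕-cancel x c) (λ x → ⊕-⊖-cancel x c)

  ∣B∣≤∣B+c∣ : ∀ (B S : Subset n) c → (∀ {s} → s ∈ B → s ⊕ c ∈ S) → ∣ B ∣ ≤ ∣ S ∣
  ∣B∣≤∣B+c∣ B S c B+c⊆S = begin
    ∣ B ∣                       ≡⟨ ∣p∣≡∑𝟙 B ⟩
    ∑[ s < n ] 𝟙 B s            ≤⟨ ∑-mono (λ s → ⟦⟧-mono (s ∈? B) (s ⊕ c ∈? S) B+c⊆S) ⟩
    ∑[ s < n ] 𝟙 S (s ⊕ c)      ≡⟨ ∑-translate c (𝟙 S) ⟩
    ∑[ s < n ] 𝟙 S s            ≡⟨ ∣p∣≡∑𝟙 S ⟨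
    ∣ S ∣                       ∎
    where open ≤-Reasoning

  ∑-reflect : ∀ c (f : Fin n → ℕ) → ∑[ x < n ] f (c ⊕ (⊖ x)) ≡ ∑[ x < n ] f x
  ∑-reflect c f = ∑-bijective reflect reflect f involutive involutive
    where
    open GroupProperties (AbelianGroup.group group) using (⁻¹-anti-homo-∙; ⁻¹-involutive)
    reflect : Fin n → Fin n
    reflect x = c ⊕ (⊖ x)
    involutive : ∀ x → reflect (reflect x) ≡ x
    involutive x = trans (cong (c ⊕_) (⁻¹-anti-homo-∙ c (⊖ x)))
      (trans (cong (c ⊕_) (cong (_⊕ (⊖ c)) (⁻¹-involutive x)))
      (trans (comm c _) (⊖-⊕-cancel x c)))

  -- The curves y = F a x + s with (a , s) ∈ A × B; two curves with
  -- a ⊕ (⊖ a′) ∉ 𝔪 meet in at most one point.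
  module _ (F : Fin n → Fin n → Fin n) (𝔪 A B : Subset n)
           (transversal : ∀ {a a′} → a ⊕ (⊖ a′) ∉ 𝔪 → Injective _≡_ _≡_ λ x → F a x ⊕ (⊖ F a′ x))
           where

    private
      N = ∣ A ∣
      T = ∣ B ∣
      M = ∣ 𝔪 ∣

    curvesThrough : Fin n → Fin n → ℕ
    curvesThrough x y = ∑[ a < n ] (𝟙 A a * 𝟙 B (y ⊕ (⊖ F a x)))

    -- Each of the N T curves is a graph, so it passes through exactly one point for each of the n
    -- values of x.
    ∑-curvesThrough : ∑[ x < n ] ∑[ y < n ] curvesThrough x y ≡ n * (N * T)
    ∑-curvesThrough = begin
      ∑[ x < n ] ∑[ y < n ] ∑[ a < n ] (𝟙 A a * 𝟙 B (y ⊕ (⊖ F a x)))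
        ≡⟨ sum-cong-≗ (λ x → ∑-comm (λ y a → 𝟙 A a * 𝟙 B (y ⊕ (⊖ F a x)))) ⟩
      ∑[ x < n ] ∑[ a < n ] ∑[ y < n ] (𝟙 A a * 𝟙 B (y ⊕ (⊖ F a x)))
        ≡⟨ sum-cong-≗ (λ x → sum-cong-≗ λ a → trans (∑-*ˡ (𝟙 A a) (λ y → 𝟙 B (y ⊕ (⊖ F a x))))
             (cong (𝟙 A a *_) (∑-translate (⊖ F a x) (𝟙 B)))) ⟩
      ∑[ x < n ] ∑[ a < n ] (𝟙 A a * ∑[ y < n ] 𝟙 B y)
        ≡⟨ sum-cong-≗ {n} (λ x → ∑-*ʳ (∑[ y < n ] 𝟙 B y) (𝟙 A)) ⟩
      ∑[ x < n ] ((∑[ a < n ] 𝟙 A a) * ∑[ y < n ] 𝟙 B y)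
        ≡⟨ ∑-const n _ ⟩
      n * ((∑[ a < n ] 𝟙 A a) * ∑[ y < n ] 𝟙 B y)
        ≡⟨ cong (n *_) (cong₂ _*_ (∣p∣≡∑𝟙 A) (∣p∣≡∑𝟙 B)) ⟨
      n * (N * T) ∎
      where open ≡-Reasoning

    private
      -- The number of points that lie both on a translate of `F a` and on a translate of `F a′` by
      -- elements of `B`; the point determines both translations.
      meet : Fin n → Fin n → ℕ
      meet a a′ = ∑[ x < n ] ∑[ y < n ] (𝟙 B (y ⊕ (⊖ F a x)) * 𝟙 B (y ⊕ (⊖ F a′ x)))

    -- For every x the first curve alone leaves at most T choices of y. This bound serves the pairs
    -- with a ⊖ a′ in `𝔪`.
    meet-≤ : ∀ a a′ → meet a a′ ≤ n * T
    meet-≤ a a′ = ∑-≤-const λ x → begin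
      ∑[ y < n ] (𝟙 B (y ⊕ (⊖ F a x)) * 𝟙 B (y ⊕ (⊖ F a′ x)))
        ≤⟨ ∑-mono (λ y → *-monoʳ-≤ (𝟙 B (y ⊕ (⊖ F a x))) (⟦⟧≤1 (y ⊕ (⊖ F a′ x) ∈? B))) ⟩
      ∑[ y < n ] (𝟙 B (y ⊕ (⊖ F a x)) * 1)
        ≡⟨ sum-cong-≗ (λ y → *-identityʳ (𝟙 B (y ⊕ (⊖ F a x)))) ⟩
      ∑[ y < n ] 𝟙 B (y ⊕ (⊖ F a x))
        ≡⟨ ∑-translate (⊖ F a x) (𝟙 B) ⟩
      ∑[ y < n ] 𝟙 B y
        ≡⟨ ∣p∣≡∑𝟙 B ⟨
      T ∎
      where open ≤-Reasoning

    -- Substitute y = s + F a x. The second curve then requires h x + s to lie in `B`, where h is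
    -- the difference of the two curves. Since h is injective, each s in `B` admits at most T values
    -- of x.
    meet-transversal : ∀ a a′ → a ⊕ (⊖ a′) ∉ 𝔪 → meet a a′ ≤ T * T
    meet-transversal a a′ ∉𝔪 = begin
      ∑[ x < n ] ∑[ y < n ] (𝟙 B (y ⊕ (⊖ F a x)) * 𝟙 B (y ⊕ (⊖ F a′ x)))
        ≡⟨ sum-cong-≗ (λ x → ∑-translate (F a x) (λ y → 𝟙 B (y ⊕ (⊖ F a x)) * 𝟙 B (y ⊕ (⊖ F a′ x)))) ⟨
      ∑[ x < n ] ∑[ s < n ] (𝟙 B ((s ⊕ F a x) ⊕ (⊖ F a x)) * 𝟙 B ((s ⊕ F a x) ⊕ (⊖ F a′ x)))
        ≡⟨ sum-cong-≗ (λ x → sum-cong-≗ λ s →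
             cong₂ (λ i j → 𝟙 B i * 𝟙 B j) (⊕-⊖-cancel s (F a x))
               (trans (assoc s (F a x) (⊖ F a′ x)) (comm s (h x)))) ⟩
      ∑[ x < n ] ∑[ s < n ] (𝟙 B s * 𝟙 B (h x ⊕ s))
        ≡⟨ ∑-comm (λ x s → 𝟙 B s * 𝟙 B (h x ⊕ s)) ⟩
      ∑[ s < n ] ∑[ x < n ] (𝟙 B s * 𝟙 B (h x ⊕ s))
        ≡⟨ sum-cong-≗ (λ s → ∑-*ˡ (𝟙 B s) (λ x → 𝟙 B (h x ⊕ s))) ⟩
      ∑[ s < n ] (𝟙 B s * ∑[ x < n ] 𝟙 B (h x ⊕ s))
        ≤⟨ ∑-mono (λ s → *-monoʳ-≤ (𝟙 B s)
             (≤-trans (∑-injective h (λ z → 𝟙 B (z ⊕ s)) (transversal ∉𝔪))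
               (≤-reflexive (∑-translate s (𝟙 B))))) ⟩
      ∑[ s < n ] (𝟙 B s * ∑[ x < n ] 𝟙 B x)
        ≡⟨ ∑-*ʳ (∑[ x < n ] 𝟙 B x) (𝟙 B) ⟩
      (∑[ s < n ] 𝟙 B s) * ∑[ x < n ] 𝟙 B x
        ≡⟨ cong₂ _*_ (∣p∣≡∑𝟙 B) (∣p∣≡∑𝟙 B) ⟨
      T * T ∎
      where
      open ≤-Reasoning
      h : Fin n → Fin n
      h x = F a x ⊕ (⊖ F a′ x)

    meet-bound : ∀ a a′ → meet a a′ ≤ T * T + 𝟙 𝔪 (a ⊕ (⊖ a′)) * (n * T)
    meet-bound a a′ with a ⊕ (⊖ a′) ∈? 𝔪
    ... | yes _ = ≤-trans (meet-≤ a a′) (≤-trans (≤-reflexive (sym (*-identityˡ (n * T)))) (m≤n+m _ (T * T)))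
    ... | no ∉𝔪 = ≤-trans (meet-transversal a a′ ∉𝔪) (m≤m+n (T * T) 0)

    -- Expanding the square counts pairs of curves through a common point, grouped by (a , a′). The
    -- transversal bound T² over all pairs gives the square of N T; the surplus n T is paid only
    -- when a and a′ are congruent modulo `𝔪`.
    ∑-curvesThrough² : ∑[ x < n ] ∑[ y < n ] (curvesThrough x y * curvesThrough x y) ≤
                       (N * T) * (N * T) + N * T * (n * M)
    ∑-curvesThrough² = begin
      ∑[ x < n ] ∑[ y < n ] (curvesThrough x y * curvesThrough x y)
        ≡⟨ sum-cong-≗ (λ x → sum-cong-≗ λ y → ∑-*-∑ (λ a → 𝟙 A a * b x y a) (λ a → 𝟙 A a * b x y a)) ⟩
      ∑[ x < n ] ∑[ y < n ] ∑[ a < n ] ∑[ a′ < n ] g x y a a′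
        ≡⟨ sum-cong-≗ (λ x → trans (∑-comm (λ y a → ∑[ a′ < n ] g x y a a′))
             (sum-cong-≗ λ a → ∑-comm (λ y a′ → g x y a a′))) ⟩
      ∑[ x < n ] ∑[ a < n ] ∑[ a′ < n ] ∑[ y < n ] g x y a a′
        ≡⟨ trans (∑-comm (λ x a → ∑[ a′ < n ] ∑[ y < n ] g x y a a′))
             (sum-cong-≗ λ a → ∑-comm (λ x a′ → ∑[ y < n ] g x y a a′)) ⟩
      ∑[ a < n ] ∑[ a′ < n ] ∑[ x < n ] ∑[ y < n ] g x y a a′
        ≡⟨ sum-cong-≗ (λ a → sum-cong-≗ λ a′ → factor a a′) ⟩
      ∑[ a < n ] ∑[ a′ < n ] (𝟙 A a * 𝟙 A a′ * meet a a′)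
        -- In the surplus term the condition a′ ∈ A is dropped, so that a′ runs through a whole
        -- coset of `𝔪` and contributes exactly M.
        ≤⟨ ∑-mono (λ a → ∑-mono λ a′ → ≤-trans (*-monoʳ-≤ (𝟙 A a * 𝟙 A a′) (meet-bound a a′)) (drop a a′)) ⟩
      ∑[ a < n ] ∑[ a′ < n ] (𝟙 A a * (𝟙 A a′ * (T * T) + 𝟙 𝔪 (a ⊕ (⊖ a′)) * (n * T)))
        ≡⟨ sum-cong-≗ (λ a → ∑-*ˡ (𝟙 A a) (λ a′ → 𝟙 A a′ * (T * T) + 𝟙 𝔪 (a ⊕ (⊖ a′)) * (n * T))) ⟩
      ∑[ a < n ] (𝟙 A a * ∑[ a′ < n ] (𝟙 A a′ * (T * T) + 𝟙 𝔪 (a ⊕ (⊖ a′)) * (n * T)))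
        ≡⟨ sum-cong-≗ (λ a → cong (𝟙 A a *_) (inner a)) ⟩
      ∑[ a < n ] (𝟙 A a * (N * (T * T) + M * (n * T)))
        ≡⟨ trans (∑-*ʳ (N * (T * T) + M * (n * T)) (𝟙 A))
             (cong (_* (N * (T * T) + M * (n * T))) (sym (∣p∣≡∑𝟙 A))) ⟩
      N * (N * (T * T) + M * (n * T))
        ≡⟨ rearrange N T M n ⟩
      (N * T) * (N * T) + N * T * (n * M) ∎
      where
      open ≤-Reasoning
      b : Fin n → Fin n → Fin n → ℕ
      b x y a = 𝟙 B (y ⊕ (⊖ F a x))

      g : Fin n → Fin n → Fin n → Fin n → ℕ
      g x y a a′ = 𝟙 A a * b x y a * (𝟙 A a′ * b x y a′)

      rearrange : ∀ N T M n → N * (N * (T * T) + M * (n * T)) ≡ (N * T) * (N * T) + N * T * (n * M)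
      rearrange = solve-∀

      interchange : ∀ i j k l → i * j * (k * l) ≡ i * k * (j * l)
      interchange = solve-∀

      factor : ∀ a a′ → ∑[ x < n ] ∑[ y < n ] g x y a a′ ≡ 𝟙 A a * 𝟙 A a′ * meet a a′
      factor a a′ = trans
        (sum-cong-≗ λ x → trans
          (sum-cong-≗ λ y → interchange (𝟙 A a) (b x y a) (𝟙 A a′) (b x y a′))
          (∑-*ˡ (𝟙 A a * 𝟙 A a′) (λ y → b x y a * b x y a′)))
        (∑-*ˡ (𝟙 A a * 𝟙 A a′) (λ x → ∑[ y < n ] (b x y a * b x y a′)))

      drop : ∀ a a′ → 𝟙 A a * 𝟙 A a′ * (T * T + 𝟙 𝔪 (a ⊕ (⊖ a′)) * (n * T)) ≤
                      𝟙 A a * (𝟙 A a′ * (T * T) + 𝟙 𝔪 (a ⊕ (⊖ a′)) * (n * T))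
      drop a a′ = ≤-trans (≤-reflexive (*-assoc (𝟙 A a) (𝟙 A a′) _)) (*-monoʳ-≤ (𝟙 A a)
        (≤-trans (≤-reflexive (*-distribˡ-+ (𝟙 A a′) (T * T) _))
          (+-monoʳ-≤ (𝟙 A a′ * (T * T)) (≤-trans (*-monoˡ-≤ _ (⟦⟧≤1 (a′ ∈? A)))
            (≤-reflexive (*-identityˡ _))))))

      inner : ∀ a → ∑[ a′ < n ] (𝟙 A a′ * (T * T) + 𝟙 𝔪 (a ⊕ (⊖ a′)) * (n * T)) ≡ N * (T * T) + M * (n * T)
      inner a = trans (∑-distrib-+ (λ a′ → 𝟙 A a′ * (T * T)) _) (cong₂ _+_
        (trans (∑-*ʳ (T * T) (𝟙 A)) (cong (_* (T * T)) (sym (∣p∣≡∑𝟙 A))))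
        (trans (∑-*ʳ (n * T) (λ a′ → 𝟙 𝔪 (a ⊕ (⊖ a′))))
          (cong (_* (n * T)) (trans (∑-reflect a (𝟙 𝔪)) (sym (∣p∣≡∑𝟙 𝔪))))))

    module _ (K S : Subset n)
             (incident : ∀ {a c} → a ∈ A → c ∈ A → c ⊕ a ∈ K)
             (incident′ : ∀ {a c s} → a ∈ A → c ∈ A → s ∈ B → s ⊕ F a (c ⊕ a) ∈ S) where

      private
        inKS : Fin n → Fin n → ℕ
        inKS x y = 𝟙 K x * 𝟙 S y

      -- The triple (a , c , s) yields the point (c + a , s + F a (c + a)) on the curve (a , s). The
      -- substitutions y = s + F a x and x = c + a are translations in s and in c, so no incidence
      -- is counted twice.
      ∑-incidences : N * (N * T) ≤ ∑[ x < n ] ∑[ y < n ] (inKS x y * curvesThrough x y)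
      ∑-incidences = begin
        N * (N * T)
          ≡⟨ cong₂ _*_ (∣p∣≡∑𝟙 A) (cong₂ _*_ (∣p∣≡∑𝟙 A) (∣p∣≡∑𝟙 B)) ⟩
        (∑[ a < n ] 𝟙 A a) * ((∑[ c < n ] 𝟙 A c) * ∑[ s < n ] 𝟙 B s)
          ≡⟨ trans (sym (∑-*ʳ _ (𝟙 A))) (sum-cong-≗ λ a → cong (𝟙 A a *_) (∑-*-∑ (𝟙 A) (𝟙 B))) ⟩
        ∑[ a < n ] (𝟙 A a * ∑[ c < n ] ∑[ s < n ] (𝟙 A c * 𝟙 B s))
          ≡⟨ sum-cong-≗ (λ a → trans (sym (∑-*ˡ (𝟙 A a) (λ c → ∑[ s < n ] (𝟙 A c * 𝟙 B s))))
               (sum-cong-≗ λ c → sym (∑-*ˡ (𝟙 A a) (λ s → 𝟙 A c * 𝟙 B s)))) ⟩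
        ∑[ a < n ] ∑[ c < n ] ∑[ s < n ] (𝟙 A a * (𝟙 A c * 𝟙 B s))
          ≤⟨ ∑-mono (λ a → ∑-mono λ c → ∑-mono λ s → step a c s) ⟩
        ∑[ a < n ] ∑[ c < n ] ∑[ s < n ] G a (c ⊕ a) (s ⊕ F a (c ⊕ a))
          ≡⟨ sum-cong-≗ (λ a → sum-cong-≗ λ c → ∑-translate (F a (c ⊕ a)) (G a (c ⊕ a))) ⟩
        ∑[ a < n ] ∑[ c < n ] ∑[ y < n ] G a (c ⊕ a) y
          ≡⟨ sum-cong-≗ (λ a → ∑-translate a (λ x → ∑[ y < n ] G a x y)) ⟩
        ∑[ a < n ] ∑[ x < n ] ∑[ y < n ] G a x y
          ≡⟨ ∑-comm (λ a x → ∑[ y < n ] G a x y) ⟩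
        ∑[ x < n ] ∑[ a < n ] ∑[ y < n ] G a x y
          ≡⟨ sum-cong-≗ (λ x → ∑-comm (λ a y → G a x y)) ⟩
        ∑[ x < n ] ∑[ y < n ] ∑[ a < n ] G a x y
          ≡⟨ sum-cong-≗ (λ x → sum-cong-≗ λ y → ∑-*ˡ (inKS x y) (λ a → 𝟙 A a * 𝟙 B (y ⊕ (⊖ F a x)))) ⟩
        ∑[ x < n ] ∑[ y < n ] (inKS x y * curvesThrough x y) ∎
        where
        open ≤-Reasoning
        G : Fin n → Fin n → Fin n → ℕ
        G a x y = inKS x y * (𝟙 A a * 𝟙 B (y ⊕ (⊖ F a x)))

        step : ∀ a c s → 𝟙 A a * (𝟙 A c * 𝟙 B s) ≤ G a (c ⊕ a) (s ⊕ F a (c ⊕ a))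
        step a c s with a ∈? A | c ∈? A | s ∈? B
        ... | no _ | _ | _ = z≤n
        ... | yes _ | no _ | _ = z≤n
        ... | yes _ | yes _ | no _ = z≤n
        ... | yes a∈A | yes c∈A | yes s∈B = ≤-reflexive (sym (cong₂ _*_
          (cong₂ _*_ (⟦⟧-yes (c ⊕ a ∈? K) (incident a∈A c∈A))
                     (⟦⟧-yes (s ⊕ F a (c ⊕ a) ∈? S) (incident′ a∈A c∈A s∈B)))
          (trans (*-identityˡ _) (trans (cong (𝟙 B) (⊕-⊖-cancel s (F a (c ⊕ a)))) (⟦⟧-yes (s ∈? B) s∈B)))))

      -- Chebyshev's inequality with D = N T: the N T curves have n points each in a plane of n²
      -- points, hence the mean is N T / n, while the set K × S carries at least N D incidences.
      incidence-bound : .{{_ : NonZero n}} .{{_ : NonZero N}} .{{_ : NonZero T}}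
                        .{{_ : NonZero ∣ K ∣}} .{{_ : NonZero ∣ S ∣}} →
        n * (N * N) * (N * T) ≤ ∣ K ∣ * ∣ S ∣ * (n * n) * M + 2 * (∣ K ∣ * ∣ S ∣) * N * (N * T)
      incidence-bound = concentration curvesThrough inKS N (N * T) (∣ K ∣ * ∣ S ∣) M
        {{it}} {{m*n≢0 N T}} {{m*n≢0 ∣ K ∣ ∣ S ∣}}
        (λ x y → trans (interchange (𝟙 K x) (𝟙 S y)) (cong₂ _*_ (⟦⟧-idem (x ∈? K)) (⟦⟧-idem (y ∈? S))))
        (trans (sym (∑-*-∑ (𝟙 K) (𝟙 S))) (sym (cong₂ _*_ (∣p∣≡∑𝟙 K) (∣p∣≡∑𝟙 S))))
        ∑-curvesThrough ∑-curvesThrough² ∑-incidences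
        where
        interchange : ∀ i j → i * j * (i * j) ≡ i * i * (j * j)
        interchange = solve-∀

-- Arithmetic of the final estimate.

square-cancel-≤ : ∀ {a b} → a * a ≤ b * b → a ≤ b
square-cancel-≤ {a} {b} aa≤bb with ≤-<-connex a b
... | inj₁ a≤b = a≤b
... | inj₂ b<a = contradiction aa≤bb (<⇒≱ (*-mono-< b<a b<a))

m≤x+y⇒m≤2x⊎m≤2y : ∀ {m} x y → m ≤ x + y → m ≤ 2 * x ⊎ m ≤ 2 * y
m≤x+y⇒m≤2x⊎m≤2y x y m≤x+y with ≤-total x y
... | inj₁ x≤y = inj₂ (≤-trans m≤x+y 
  (≤-trans (+-monoˡ-≤ y x≤y) (+-monoʳ-≤ y (≤-reflexive (sym (+-identityʳ y))))))
... | inj₂ y≤x = inj₁ (≤-trans m≤x+y (+-monoʳ-≤ x (≤-trans y≤x (≤-reflexive (sym (+-identityʳ x))))))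

-- Since M is at most two thirds of N, at least one third of N is left for 2 T.
many-squares : ∀ M N T → 3 * M ≤ 2 * N → N ≤ M + 2 * T → N ≤ 6 * T
many-squares M N T 3M≤2N N≤ = +-cancelˡ-≤ (2 * N) N (6 * T) (begin
  2 * N + N            ≡⟨ ℕ-solve (N ∷ []) ⟩
  3 * N                ≤⟨ *-monoʳ-≤ 3 N≤ ⟩
  3 * (M + 2 * T)      ≡⟨ ℕ-solve (M ∷ T ∷ []) ⟩
  3 * M + 6 * T        ≤⟨ +-monoˡ-≤ (6 * T) 3M≤2N ⟩
  2 * N + 6 * T        ∎)
  where open ≤-Reasoning

-- With Q = q M, the bound K ≤ Q turns Q³ ≤ K N² q into q M² ≤ N². Then 9 M² ≤ 4 q M² ≤ 4 N²,
-- because q ≥ 3 gives 9 ≤ 4 q.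
few-nonunits : ∀ q M N K .{{_ : NonZero q}} .{{_ : NonZero M}} →
               q * M * (q * M) * (q * M) ≤ K * (N * N) * q → 3 ≤ q → K ≤ q * M → 3 * M ≤ 2 * N
few-nonunits q M N K Q³≤KN²q 3≤q K≤Q = square-cancel-≤ (begin
  3 * M * (3 * M)          ≡⟨ ℕ-solve (M ∷ []) ⟩
  3 * (3 * (M * M))        ≤⟨ *-monoˡ-≤ (3 * (M * M)) (n≤1+n 3) ⟩
  4 * (3 * (M * M))        ≤⟨ *-monoʳ-≤ 4 (*-monoˡ-≤ (M * M) 3≤q) ⟩
  4 * (q * (M * M))        ≤⟨ *-monoʳ-≤ 4 qMM≤NN ⟩
  4 * (N * N)              ≡⟨ ℕ-solve (N ∷ []) ⟩
  2 * N * (2 * N)          ∎)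
  where
  open ≤-Reasoning
  qMM≤NN : q * (M * M) ≤ N * N
  qMM≤NN = *-cancelˡ-≤ (q * (q * M)) {{m*n≢0 q (q * M) {{it}} {{m*n≢0 q M}}}} (begin
    q * (q * M) * (q * (M * M))  ≡⟨ ℕ-solve (q ∷ M ∷ []) ⟩
    q * M * (q * M) * (q * M)    ≤⟨ Q³≤KN²q ⟩
    K * (N * N) * q              ≤⟨ *-monoˡ-≤ q (*-monoˡ-≤ (N * N) K≤Q) ⟩
    q * M * (N * N) * q          ≡⟨ ℕ-solve (q ∷ M ∷ N ∷ []) ⟩
    q * (q * M) * (N * N)        ∎)

main-term : ∀ Q N W → N ≤ Q → Q * N ≤ 4 * W → Q * (N * N * N) ≤ 12 * W * (12 * W)
main-term Q N W N≤Q QN≤4W = begin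
  Q * (N * N * N)      ≡⟨ ℕ-solve (Q ∷ N ∷ []) ⟩
  Q * N * (N * N)      ≤⟨ *-monoʳ-≤ (Q * N) (*-monoˡ-≤ N N≤Q) ⟩
  Q * N * (Q * N)      ≤⟨ *-mono-≤ QN≤12W QN≤12W ⟩
  12 * W * (12 * W)    ∎
  where
  open ≤-Reasoning
  QN≤12W : Q * N ≤ 12 * W
  -- The constant 4 is weakened to the 12 that the other case requires.
  QN≤12W = ≤-trans QN≤4W (*-monoˡ-≤ W (m≤m+n 4 8))

-- The two lower bounds for W complement each other. If Q⁵ ≤ N⁵ q², then Q⁵ N³ ≤ N⁸ q², and squaring
-- the last hypothesis bounds this by (12 W)² Q⁴. Otherwise squaring the first hypothesis gives Q N⁵
-- q² ≤ Q⁶ ≤ K² N⁴ q², that is, Q N³ ≤ (K N)².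
error-term : ∀ Q q N K W .{{_ : NonZero Q}} .{{_ : NonZero q}} .{{_ : NonZero N}} →
             Q * Q * Q ≤ K * (N * N) * q → K * N ≤ 12 * W → N * N * N * N * q ≤ 12 * W * (Q * Q) →
             Q * (N * N * N) ≤ 12 * W * (12 * W)
error-term Q q N K W Q³≤KN²q KN≤12W N⁴q≤12WQ²
  with ≤-total (Q * Q * Q * Q * Q) (N * N * N * N * N * (q * q))
... | inj₁ Q⁵≤N⁵q² = *-cancelˡ-≤ (Q * Q * (Q * Q)) {{m*n≢0 (Q * Q) (Q * Q) {{m*n≢0 Q Q}} {{m*n≢0 Q Q}}}} (begin
  Q * Q * (Q * Q) * (Q * (N * N * N))            ≡⟨ ℕ-solve (Q ∷ N ∷ []) ⟩
  Q * Q * Q * Q * Q * (N * N * N)                ≤⟨ *-monoˡ-≤ (N * N * N) Q⁵≤N⁵q² ⟩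
  N * N * N * N * N * (q * q) * (N * N * N)      ≡⟨ ℕ-solve (q ∷ N ∷ []) ⟩
  N * N * N * N * q * (N * N * N * N * q)        ≤⟨ *-mono-≤ N⁴q≤12WQ² N⁴q≤12WQ² ⟩
  12 * W * (Q * Q) * (12 * W * (Q * Q))          ≡⟨ ℕ-solve (W ∷ Q ∷ []) ⟩
  Q * Q * (Q * Q) * (12 * W * (12 * W))          ∎)
  where open ≤-Reasoning
... | inj₂ N⁵q²≤Q⁵ = ≤-trans QN³≤KNKN (*-mono-≤ KN≤12W KN≤12W)
  where
  open ≤-Reasoning
  QN³≤KNKN : Q * (N * N * N) ≤ K * N * (K * N)
  QN³≤KNKN = *-cancelˡ-≤ (N * N * (q * q)) {{m*n≢0 (N * N) (q * q) {{m*n≢0 N N}} {{m*n≢0 q q}}}} (begin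
    N * N * (q * q) * (Q * (N * N * N))            ≡⟨ ℕ-solve (N ∷ q ∷ Q ∷ []) ⟩
    Q * (N * N * N * N * N * (q * q))              ≤⟨ *-monoʳ-≤ Q N⁵q²≤Q⁵ ⟩
    Q * (Q * Q * Q * Q * Q)                        ≡⟨ ℕ-solve (Q ∷ []) ⟩
    Q * Q * Q * (Q * Q * Q)                        ≤⟨ *-mono-≤ Q³≤KN²q Q³≤KN²q ⟩
    K * (N * N) * q * (K * (N * N) * q)            ≡⟨ ℕ-solve (K ∷ N ∷ q ∷ []) ⟩
    N * N * (q * q) * (K * N * (K * N))            ∎)

optimise : ∀ q M N T K S .{{_ : NonZero q}} .{{_ : NonZero M}} .{{_ : NonZero N}} .{{_ : NonZero T}} →
           q * M * (q * M) * (q * M) ≤ K * (N * N) * q → N ≤ 6 * T → T ≤ S → N ≤ q * M →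
           q * M * (N * N) * (N * T) ≤ K * S * (q * M * (q * M)) * M + 2 * (K * S) * N * (N * T) →
           q * M * (N * N * N) ≤ 12 * (K * S) * (12 * (K * S))
optimise q M N T K S Q³≤KN²q N≤6T T≤S N≤Q bound
  with m≤x+y⇒m≤2x⊎m≤2y (K * S * (q * M * (q * M)) * M) (2 * (K * S) * N * (N * T)) bound
-- The left-hand side is at most twice the second summand; cancelling N · N T leaves Q N ≤ 4 K S.
... | inj₂ ≤main = main-term (q * M) N (K * S) N≤Q
  (*-cancelˡ-≤ (N * (N * T)) {{m*n≢0 N (N * T) {{it}} {{m*n≢0 N T}}}} (begin
  N * (N * T) * (q * M * N)             ≡⟨ ℕ-solve (N ∷ T ∷ q ∷ M ∷ []) ⟩
  q * M * (N * N) * (N * T)             ≤⟨ ≤main ⟩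
  2 * (2 * (K * S) * N * (N * T))       ≡⟨ ℕ-solve (N ∷ T ∷ K ∷ S ∷ []) ⟩
  N * (N * T) * (4 * (K * S))           ∎))
  where open ≤-Reasoning
-- The left-hand side is at most twice the first summand. One factor Q cancels, and trading one N
-- for 6 T makes the constant 2 · 6 = 12.
... | inj₁ ≤error = error-term (q * M) q N K (K * S) {{m*n≢0 q M}} Q³≤KN²q KN≤12KS (begin
  N * N * N * N * q                     ≤⟨ *-monoˡ-≤ q (*-monoʳ-≤ (N * N * N) N≤6T) ⟩
  N * N * N * (6 * T) * q               ≡⟨ ℕ-solve (N ∷ T ∷ q ∷ []) ⟩
  N * N * (N * T) * (6 * q)             ≤⟨ *-monoˡ-≤ (6 * q) (*-cancelˡ-≤ (q * M) {{m*n≢0 q M}} (begin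
    q * M * (N * N * (N * T))             ≡⟨ *-assoc (q * M) (N * N) (N * T) ⟨
    q * M * (N * N) * (N * T)             ≤⟨ ≤error ⟩
    2 * (K * S * (q * M * (q * M)) * M)   ≡⟨ ℕ-solve (q ∷ M ∷ K ∷ S ∷ []) ⟩
    q * M * (2 * (K * S) * (q * M) * M)   ∎)) ⟩
  2 * (K * S) * (q * M) * M * (6 * q)   ≡⟨ ℕ-solve (q ∷ M ∷ K ∷ S ∷ []) ⟩
  12 * (K * S) * (q * M * (q * M))      ∎)
  where
  open ≤-Reasoning
  KN≤12KS : K * N ≤ 12 * (K * S)
  KN≤12KS = begin
    K * N              ≤⟨ *-monoʳ-≤ K N≤6T ⟩
    K * (6 * T)        ≤⟨ *-monoʳ-≤ K (*-mono-≤ (m≤m+n 6 6) T≤S) ⟩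
    K * (12 * S)       ≡⟨ ℕ-solve (K ∷ S ∷ []) ⟩
    12 * (K * S)       ∎

-- Parabolas and squares when 2 lies outside the maximal ideal.

module LocalRing {n : ℕ} {add mul : Op₂ (Fin n)} {neg : Op₁ (Fin n)} {zer one : Fin n}
                 (isCommutativeRing : IsCommutativeRing _≡_ add mul neg zer one)
                 (𝔪 : Subset n)
                 (𝔪-+-closed : ∀ {x y} → x ∈ 𝔪 → y ∈ 𝔪 → add x y ∈ 𝔪)
                 (𝔪-prime : ∀ {x y} → x ∉ 𝔪 → mul x y ∈ 𝔪 → y ∈ 𝔪)
                 (regular : ∀ {x y} → x ∉ 𝔪 → mul x y ≡ zer → y ≡ zer)
                 (2∉𝔪 : add one one ∉ 𝔪) where

  private
    ring : CommutativeRing _ _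
    ring = record { isCommutativeRing = isCommutativeRing }
  open CommutativeRing ring
    using (commutativeSemiring; +-group; +-isAbelianGroup)
    renaming (_+_ to infixl 6 _⊕_; _-_ to infixl 6 _⊝_; _*_ to infixl 7 _⊗_; -_ to infix 8 ⊖_;
              0# to 𝟘; 1# to 𝟏; +-assoc to ⊕-assoc; +-comm to ⊕-comm;
              +-identityʳ to ⊕-identityʳ; *-comm to ⊗-comm)
  open import Algebra.Solver.Ring.NaturalCoefficients.Default commutativeSemiring
    using (solve; _:=_; _:+_; _:*_; con)
  open GroupProperties +-group using (identityʳ-unique; inverseˡ-unique)
  open Incidences +-isAbelianGroup

  ⊕-⊝-cancel : ∀ x y → y ⊕ (x ⊝ y) ≡ x
  ⊕-⊝-cancel x y = trans (⊕-comm y (x ⊝ y)) (⊖-⊕-cancel x y)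

  parabola : Fin n → Fin n → Fin n
  parabola a x = (x ⊝ a) ⊗ (x ⊝ a)

  -- Two parabolas meet where (1 ⊕ 1) (a ⊝ a′) x takes a prescribed value.
  parabola-transversal : ∀ {a a′} → (a ⊝ a′) ∉ 𝔪 → Injective _≡_ _≡_ λ x → parabola a x ⊝ parabola a′ x
  parabola-transversal {a} {a′} d∉𝔪 {x} {y} eq =
    trans (sym (⊖-⊕-cancel x a)) (trans (cong (_⊕ a) p≡r) (⊖-⊕-cancel y a))
    where
    open ≡-Reasoning
    d = a ⊝ a′
    p = x ⊝ a
    r = y ⊝ a
    e = p ⊝ r

    shift : ∀ z → (z ⊝ a) ⊕ d ≡ z ⊝ a′
    shift z = trans (sym (⊕-assoc (z ⊝ a) a (⊖ a′))) (cong (_⊝ a′) (⊖-⊕-cancel z a))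

    swap : ∀ {u u′ v v′} → u ⊝ u′ ≡ v ⊝ v′ → u ⊕ v′ ≡ v ⊕ u′
    swap {u} {u′} {v} {v′} u-u′≡v-v′ = begin
      u ⊕ v′                 ≡⟨ cong (_⊕ v′) (⊖-⊕-cancel u u′) ⟨
      ((u ⊝ u′) ⊕ u′) ⊕ v′   ≡⟨ cong (λ z → (z ⊕ u′) ⊕ v′) u-u′≡v-v′ ⟩
      ((v ⊝ v′) ⊕ u′) ⊕ v′   ≡⟨ solve 3 (λ i j k → (i :+ j) :+ k := (i :+ k) :+ j) refl (v ⊝ v′) u′ v′ ⟩
      ((v ⊝ v′) ⊕ v′) ⊕ u′   ≡⟨ cong (_⊕ u′) (⊖-⊕-cancel v v′) ⟩
      v ⊕ u′                 ∎

    -- Since x ⊝ a′ = p ⊕ d and y ⊝ a′ = r ⊕ d, this is the hypothesis with its subtractions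
    -- cleared, a form accessible to the semiring solver.
    squares-of-sums : p ⊗ p ⊕ (r ⊕ d) ⊗ (r ⊕ d) ≡ r ⊗ r ⊕ (p ⊕ d) ⊗ (p ⊕ d)
    squares-of-sums = swap (trans (cong (λ z → p ⊗ p ⊝ z ⊗ z) (shift x))
      (trans eq (cong (λ z → r ⊗ r ⊝ z ⊗ z) (sym (shift y)))))

    -- Putting p = r ⊕ e makes the two sides of `squares-of-sums` differ by exactly 2 d e.
    2de≡0 : (𝟏 ⊕ 𝟏) ⊗ (d ⊗ e) ≡ 𝟘
    2de≡0 = identityʳ-unique (p ⊗ p ⊕ (r ⊕ d) ⊗ (r ⊕ d)) _ (sym (begin
      p ⊗ p ⊕ (r ⊕ d) ⊗ (r ⊕ d)
        ≡⟨ squares-of-sums ⟩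
      r ⊗ r ⊕ (p ⊕ d) ⊗ (p ⊕ d)
        ≡⟨ cong (λ z → r ⊗ r ⊕ (z ⊕ d) ⊗ (z ⊕ d)) (⊕-⊝-cancel p r) ⟨
      r ⊗ r ⊕ ((r ⊕ e) ⊕ d) ⊗ ((r ⊕ e) ⊕ d)
        ≡⟨ solve 3 (λ r e d → r :* r :+ ((r :+ e) :+ d) :* ((r :+ e) :+ d) :=
             ((r :+ e) :* (r :+ e) :+ (r :+ d) :* (r :+ d)) :+ (con 1 :+ con 1) :* (d :* e)) refl r e d ⟩
      ((r ⊕ e) ⊗ (r ⊕ e) ⊕ (r ⊕ d) ⊗ (r ⊕ d)) ⊕ (𝟏 ⊕ 𝟏) ⊗ (d ⊗ e)
        ≡⟨ cong (λ z → (z ⊗ z ⊕ (r ⊕ d) ⊗ (r ⊕ d)) ⊕ (𝟏 ⊕ 𝟏) ⊗ (d ⊗ e)) (⊕-⊝-cancel p r) ⟩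
      (p ⊗ p ⊕ (r ⊕ d) ⊗ (r ⊕ d)) ⊕ (𝟏 ⊕ 𝟏) ⊗ (d ⊗ e) ∎))

    e≡0 : e ≡ 𝟘
    e≡0 = regular d∉𝔪 (regular 2∉𝔪 2de≡0)

    p≡r : p ≡ r
    p≡r = trans (sym (⊕-⊝-cancel p r)) (trans (cong (r ⊕_) e≡0) (⊕-identityʳ r))

  -- Factor x² - y² as (x - y)(y + x). A factor outside `𝔪` can be cancelled, so the other one is
  -- zero. Both factors cannot lie in `𝔪`, since their sum is 2 x and neither 2 nor x lies in the
  -- prime ideal `𝔪`.
  square-roots : ∀ {x y} → x ∉ 𝔪 → x ⊗ x ≡ y ⊗ y → x ≡ y ⊎ ⊖ x ≡ y
  square-roots {x} {y} x∉𝔪 xx≡yy = cases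
    where
    open ≡-Reasoning
    product≡0 : (x ⊝ y) ⊗ (y ⊕ x) ≡ 𝟘
    product≡0 = identityʳ-unique (y ⊗ y) _ (begin
      y ⊗ y ⊕ (x ⊝ y) ⊗ (y ⊕ x)
        ≡⟨ cong (λ z → y ⊗ y ⊕ (x ⊝ y) ⊗ (y ⊕ z)) (⊕-⊝-cancel x y) ⟨
      y ⊗ y ⊕ (x ⊝ y) ⊗ (y ⊕ (y ⊕ (x ⊝ y)))
        ≡⟨ solve 2 (λ y d → y :* y :+ d :* (y :+ (y :+ d)) := (y :+ d) :* (y :+ d)) refl y (x ⊝ y) ⟩
      (y ⊕ (x ⊝ y)) ⊗ (y ⊕ (x ⊝ y))
        ≡⟨ cong (λ z → z ⊗ z) (⊕-⊝-cancel x y) ⟩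
      x ⊗ x
        ≡⟨ xx≡yy ⟩
      y ⊗ y ∎)

    cases : x ≡ y ⊎ ⊖ x ≡ y
    cases with (x ⊝ y) ∈? 𝔪 | (y ⊕ x) ∈? 𝔪
    ... | no d∉𝔪 | _ = inj₂ (sym (inverseˡ-unique y x (regular d∉𝔪 product≡0)))
    ... | yes _ | no s∉𝔪 = inj₁ (begin
      x              ≡⟨ ⊕-⊝-cancel x y ⟨
      y ⊕ (x ⊝ y)    ≡⟨ cong (y ⊕_) (regular s∉𝔪 (trans (⊗-comm (y ⊕ x) (x ⊝ y)) product≡0)) ⟩
      y ⊕ 𝟘          ≡⟨ ⊕-identityʳ y ⟩
      y              ∎)
    ... | yes d∈𝔪 | yes s∈𝔪 = contradiction (𝔪-prime 2∉𝔪 (subst (_∈ 𝔪) 2x (𝔪-+-closed d∈𝔪 s∈𝔪))) x∉𝔪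
      where
      2x : (x ⊝ y) ⊕ (y ⊕ x) ≡ (𝟏 ⊕ 𝟏) ⊗ x
      2x = begin
        (x ⊝ y) ⊕ (y ⊕ x)   ≡⟨ ⊕-assoc (x ⊝ y) y x ⟨
        ((x ⊝ y) ⊕ y) ⊕ x   ≡⟨ cong (_⊕ x) (⊖-⊕-cancel x y) ⟩
        x ⊕ x               ≡⟨ solve 1 (λ x → x :+ x := (con 1 :+ con 1) :* x) refl x ⟩
        (𝟏 ⊕ 𝟏) ⊗ x       ∎

  -- The elements of `A` inside `𝔪` are estimated trivially; outside `𝔪` squaring is at most
  -- two-to-one.
  ∣A∣≤∣𝔪∣+2∣A²∣ : (A B : Subset n) → (∀ {x} → x ∈ A → (x ⊗ x) ∈ B) → ∣ A ∣ ≤ ∣ 𝔪 ∣ + 2 * ∣ B ∣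
  ∣A∣≤∣𝔪∣+2∣A²∣ A B square∈B = begin
    ∣ A ∣
      ≡⟨ ∣p∣≡∑𝟙 A ⟩
    ∑[ x < n ] 𝟙 A x
      ≤⟨ ∑-mono (λ x → split x (x ∈? A) (x ∈? 𝔪)) ⟩
    ∑[ x < n ] (𝟙 𝔪 x + unit x * 𝟙 B (x ⊗ x))
      ≡⟨ ∑-distrib-+ (𝟙 𝔪) _ ⟩
    (∑[ x < n ] 𝟙 𝔪 x) + (∑[ x < n ] (unit x * 𝟙 B (x ⊗ x)))
      ≤⟨ +-mono-≤ (≤-reflexive (sym (∣p∣≡∑𝟙 𝔪))) (∑-fibres unit (λ x → x ⊗ x) (𝟙 B) fibre≤2) ⟩
    ∣ 𝔪 ∣ + 2 * (∑[ y < n ] 𝟙 B y)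
      ≡⟨ cong (λ z → ∣ 𝔪 ∣ + 2 * z) (∣p∣≡∑𝟙 B) ⟨
    ∣ 𝔪 ∣ + 2 * ∣ B ∣ ∎
    where
    open ≤-Reasoning
    unit : Fin n → ℕ
    unit x = ⟦ ¬? (x ∈? 𝔪) ⟧

    split : ∀ x (d : Dec (x ∈ A)) (e : Dec (x ∈ 𝔪)) → ⟦ d ⟧ ≤ ⟦ e ⟧ + ⟦ ¬? e ⟧ * 𝟙 B (x ⊗ x)
    split x (no _)    _       = z≤n
    split x (yes _)   (yes _) = s≤s z≤n
    split x (yes x∈A) (no _)  = ≤-reflexive (sym (trans (*-identityˡ _) (⟦⟧-yes (x ⊗ x ∈? B) (square∈B x∈A))))

    root : Fin n → Fin 2 → Fin n
    root x zero    = x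
    root x (suc _) = ⊖ x

    fibre≤2 : ∀ y → ∑[ x < n ] (unit x * ⟦ x ⊗ x ≟ y ⟧) ≤ 2
    fibre≤2 y = ≤-trans
      (∑-mono λ x → ⟦⟧-*-mono (¬? (x ∈? 𝔪)) (x ⊗ x ≟ y) (¬? (x ∈? 𝔪) ×-dec (x ⊗ x ≟ y)) _,_)
      (∑-⟦⟧-≤ 2 (λ x → ¬? (x ∈? 𝔪) ×-dec (x ⊗ x ≟ y)) root candidate)
      where
      candidate : ∀ {i j} → i ∉ 𝔪 × i ⊗ i ≡ y → j ∉ 𝔪 × j ⊗ j ≡ y → ∃[ l ] root i l ≡ j
      candidate (i∉𝔪 , ii≡y) (_ , jj≡y) with square-roots i∉𝔪 (trans ii≡y (sym jj≡y))
      ... | inj₁ eq = zero , eq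
      ... | inj₂ eq = suc zero , eq

-- Decidable subsets and the ring structure on indices.

module _ {P : Pred (Fin n) ℓ′} (P? : Decidable P) where

  ∈-tabulate⁻ : ∀ {i} → i ∈ tabulate (does ∘ P?) → P i
  ∈-tabulate⁻ {i} i∈ with P? i | trans (sym (lookup∘tabulate (does ∘ P?) i)) ([]=⇒lookup i∈)
  ... | yes p | _  = p
  ... | no _  | ()

  ∈-tabulate⁺ : ∀ {i} → P i → i ∈ tabulate (does ∘ P?)
  ∈-tabulate⁺ {i} p = lookup⇒[]= i _ (trans (lookup∘tabulate (does ∘ P?) i) (dec-true (P? i) p))

module FiniteRing (R : FiniteCommutativeRing a ℓ) where
  open FiniteCommutativeRing R renaming (refl to ≈-refl; sym to ≈-sym; trans to ≈-trans)

  index-element : ∀ i → index (element i) ≡ i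
  index-element i = inverseʳ ≈-refl

  element-index : ∀ x → element (index x) ≈ x
  element-index x = inverseˡ refl

  element-injective : ∀ {i j} → element i ≈ element j → i ≡ j
  element-injective eq = trans (sym (index-element _)) (trans (from-cong eq) (index-element _))

  index-injective : ∀ {x y} → index x ≡ index y → x ≈ y
  index-injective eq = ≈-trans (≈-sym (element-index _)) (≈-trans (to-cong eq) (element-index _))

  -- On indices equality is propositional, so the counting lemmas over `Fin` apply directly; the
  -- ring laws are pulled back along the injection `element`.
  finRawRing : RawRing _ _
  finRawRing = record
    { Carrier = Fin size
    ; _≈_     = _≡_
    ; _+_     = λ i j → index (element i +′ element j)
    ; _*_     = λ i j → index (element i *′ element j)
    ; -_      = λ i → index (- element i)
    ; 0#      = index 0#
    ; 1#      = index 1#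
    }
    where open FiniteCommutativeRing R using () renaming (_+_ to _+′_; _*_ to _*′_)

  element-isRingMonomorphism : IsRingMonomorphism finRawRing rawRing element
  element-isRingMonomorphism = record
    { isRingHomomorphism = record
      { isSemiringHomomorphism = record
        { isNearSemiringHomomorphism = record
          { +-isMonoidHomomorphism = record
            { isMagmaHomomorphism = record
              { isRelHomomorphism = record { cong = to-cong }
              ; homo = λ _ _ → element-index _
              }
            ; ε-homo = element-index _
            }
          ; *-homo = λ _ _ → element-index _
          }
        ; 1#-homo = element-index _
        }
      ; -‿homo = λ _ → element-index _
      }
    ; injective = element-injective
    }

  open RawRing finRawRing using () renaming (_+_ to fin+; _*_ to fin*; -_ to fin-; 0# to fin0; 1# to fin1)
    public

  finIsCommutativeRing : IsCommutativeRing _≡_ fin+ fin* fin- fin0 fin1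
  finIsCommutativeRing = RingMonomorphism.isCommutativeRing element-isRingMonomorphism isCommutativeRing

-- Uniformiser, powers of the maximal ideal and units.

module ValuationRing {R : FiniteCommutativeRing a ℓ} {q r : ℕ} (V : IsValuationRing R q r) where
  open FiniteCommutativeRing R
    hiding (zero)
    renaming (refl to ≈-refl; sym to ≈-sym; trans to ≈-trans;
              _+_ to infixl 6 _⊕_; _-_ to infixl 6 _⊝_; _*_ to infixl 7 _⊗_; -_ to infix 8 ⊖_;
              0# to 𝟘; 1# to 𝟏; +-assoc to ⊕-assoc; +-comm to ⊕-comm;
              +-identityʳ to ⊕-identityʳ; +-identityˡ to ⊕-identityˡ;
              *-comm to ⊗-comm; *-identityˡ to ⊗-identityˡ;
              +-cong to ⊕-cong; +-congˡ to ⊕-congˡ; +-congʳ to ⊕-congʳ;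
              *-cong to ⊗-cong; *-congˡ to ⊗-congˡ; *-congʳ to ⊗-congʳ; zeroʳ to ⊗-zeroʳ; zeroˡ to ⊗-zeroˡ)
  open FiniteRing R
  open IsValuationRing V public
  open IsMaximal 𝔪-isMaximal public
  open IsIdeal isIdeal
  open import Algebra.Properties.Semiring.Exp semiring using () renaming (_^_ to infixr 8 _^ᴿ_)
  open import Algebra.Solver.Ring.NaturalCoefficients.Default commutativeSemiring
    using (solve; _:=_; _:+_; _:*_; con)
  open GroupProperties +-group using (identityʳ-unique; ∙-cancelˡ)
  open import Relation.Binary.Reasoning.Setoid setoid

  private
    infix 4 _∋𝔪
    _∋𝔪 : Carrier → Set
    x ∋𝔪 = index x ∈ 𝔪

    respects : ∀ {x y} → x ≈ y → x ∋𝔪 → y ∋𝔪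
    respects x≈y = subst (_∈ 𝔪) (from-cong x≈y)

  ⊕-⊝-cancel : ∀ x y → y ⊕ (x ⊝ y) ≈ x
  ⊕-⊝-cancel x y = begin
    y ⊕ (x ⊕ ⊖ y)   ≈⟨ ⊕-comm y _ ⟩
    (x ⊕ ⊖ y) ⊕ y   ≈⟨ ⊕-assoc x (⊖ y) y ⟩
    x ⊕ (⊖ y ⊕ y)   ≈⟨ ⊕-congˡ (-‿inverseˡ y) ⟩
    x ⊕ 𝟘           ≈⟨ ⊕-identityʳ x ⟩
    x               ∎

  -- A uniformiser of the ring.
  π : Carrier
  π = proj₁ (principal 𝔪 isIdeal)

  module _ {x : Carrier} where
    open Equivalence (proj₂ (principal 𝔪 isIdeal) x) public
      using () renaming (to to 𝔪⇒multiple; from to multiple⇒𝔪)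

  module _ (x : Carrier) where

    private
      -- Membership in the ideal (x , π). The coefficients range over indices, which makes it
      -- decidable by exhaustive search.
      I? : Decidable (λ i → ∃[ j ] ∃[ k ] i ≡ index (element j ⊗ x ⊕ element k ⊗ π))
      I? i = any? λ j → any? λ k → i ≟ index (element j ⊗ x ⊕ element k ⊗ π)

      I : Subset size
      I = tabulate (does ∘ I?)

      ∋I⁺ : ∀ {z} y t → z ≈ y ⊗ x ⊕ t ⊗ π → _∋_ R I z
      ∋I⁺ y t eq = ∈-tabulate⁺ I? (index y , index t , from-cong (≈-trans eq (≈-sym
        (⊕-cong (⊗-congʳ (element-index y)) (⊗-congʳ (element-index t))))))

      ∋I⁻ : ∀ {z} → _∋_ R I z → ∃[ y ] ∃[ t ] z ≈ y ⊗ x ⊕ t ⊗ π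
      ∋I⁻ z∈I with j , k , eq ← ∈-tabulate⁻ I? z∈I = element j , element k , index-injective eq

      I-isIdeal : IsIdeal R I
      I-isIdeal = record
        { 0-closed = ∋I⁺ 𝟘 𝟘 (≈-sym (≈-trans (⊕-cong (⊗-zeroˡ x) (⊗-zeroˡ π)) (⊕-identityʳ 𝟘)))
        ; +-closed = λ u∈I v∈I → let y , t , u≈ = ∋I⁻ u∈I ; y′ , t′ , v≈ = ∋I⁻ v∈I in
            ∋I⁺ (y ⊕ y′) (t ⊕ t′) (≈-trans (⊕-cong u≈ v≈)
              (solve 6 (λ y x t π y′ t′ → (y :* x :+ t :* π) :+ (y′ :* x :+ t′ :* π) :=
                (y :+ y′) :* x :+ (t :+ t′) :* π) ≈-refl y x t π y′ t′))
        ; *-closed = λ s u∈I → let y , t , u≈ = ∋I⁻ u∈I in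
            ∋I⁺ (s ⊗ y) (s ⊗ t) (≈-trans (⊗-congˡ u≈)
              (solve 5 (λ s y x t π → s :* (y :* x :+ t :* π) :=
                (s :* y) :* x :+ (s :* t) :* π) ≈-refl s y x t π))
        }

    -- The ideal (x , π) contains `𝔪`. If it were proper, maximality would place it, and with it x,
    -- inside `𝔪`.
    bezout : ¬ (x ∋𝔪) → ∃[ y ] ∃[ t ] 𝟏 ≈ y ⊗ x ⊕ t ⊗ π
    bezout x∉𝔪 with index 𝟏 ∈? I
    ... | yes 1∈I = ∋I⁻ 1∈I
    ... | no 1∉I = contradiction (maximal I I-isIdeal 1∉I 𝔪⊆I x∈I) x∉𝔪
      where
      𝔪⊆I : ∀ {z} → z ∋𝔪 → _∋_ R I z
      𝔪⊆I z∈𝔪 with t , z≈ ← 𝔪⇒multiple z∈𝔪 =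
        ∋I⁺ 𝟘 t (≈-trans z≈ (≈-sym (≈-trans (⊕-congʳ (⊗-zeroˡ x)) (⊕-identityˡ _))))

      x∈I : _∋_ R I x
      x∈I = ∋I⁺ 𝟏 𝟘 (≈-sym (≈-trans (⊕-cong (⊗-identityˡ x) (⊗-zeroˡ π)) (⊕-identityʳ x)))

  π∈𝔪 : π ∋𝔪
  π∈𝔪 = multiple⇒𝔪 (𝟏 , ≈-sym (⊗-identityˡ π))

  π^k∈𝔪^k : ∀ k → power R 𝔪 k (π ^ᴿ k)
  π^k∈𝔪^k zero    = tt
  π^k∈𝔪^k (suc k) = cons π∈𝔪 (π^k∈𝔪^k k) (empty ≈-refl) (≈-sym (⊕-identityʳ _))

  -- Together with `π^k∈𝔪^k` this shows that the k-th power of `𝔪` is generated by π ^ k, which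
  -- turns the nilpotency index of `𝔪` into that of π.
  𝔪^k⇒multiple : ∀ k {x} → power R 𝔪 k x → ∃[ t ] x ≈ t ⊗ π ^ᴿ k
  𝔪^k⇒multiple zero    {x} _ = x , ≈-sym (≈-trans (⊗-comm x 𝟏) (⊗-identityˡ x))
  𝔪^k⇒multiple (suc k) (empty z≈0) = 𝟘 , ≈-trans z≈0 (≈-sym (⊗-zeroˡ _))
  𝔪^k⇒multiple (suc k) (cons x∈ y∈ w∈ z≈)
    with t , x≈ ← 𝔪⇒multiple x∈ | u , y≈ ← 𝔪^k⇒multiple k y∈ | v , w≈ ← 𝔪^k⇒multiple (suc k) w∈ =
    t ⊗ u ⊕ v , ≈-trans z≈ (≈-trans (⊕-cong (⊗-cong x≈ y≈) w≈)
      (solve 5 (λ t u v π p → (t :* π) :* (u :* p) :+ v :* (π :* p) :=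
        (t :* u :+ v) :* (π :* p)) ≈-refl t u v π (π ^ᴿ k)))

  π^r≈0 : π ^ᴿ r ≈ 𝟘
  π^r≈0 = proj₁ nilpotencyIndex (π^k∈𝔪^k r)

  -- Otherwise 1 = π ^ 0 would vanish and hence lie in `𝔪`.
  r≢0 : r ≢ 0
  r≢0 r≡0 = proper (respects (≈-sym (subst (λ k → π ^ᴿ k ≈ 𝟘) r≡0 π^r≈0)) 0-closed)

  π^k≉0 : ∀ {k} → k < r → ¬ (π ^ᴿ k ≈ 𝟘)
  π^k≉0 {k} k<r π^k≈0 = <⇒≱ k<r (proj₂ nilpotencyIndex k λ x∈ →
    let t , x≈ = 𝔪^k⇒multiple k x∈ in ≈-trans x≈ (≈-trans (⊗-congˡ π^k≈0) (⊗-zeroʳ t)))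

  -- If y x + t π = 1 and x u = 0, then u = t π u = t² π² u = … = t ^ r π ^ r u.
  regular : ∀ {x u} → ¬ (x ∋𝔪) → x ⊗ u ≈ 𝟘 → u ≈ 𝟘
  regular {x} {u} x∉𝔪 xu≈0 with y , t , 1≈ ← bezout x x∉𝔪 =
    let v , u≈ = divisible r in ≈-trans u≈ (≈-trans (⊗-congˡ π^r≈0) (⊗-zeroʳ v))
    where
    u≈tπu : u ≈ (t ⊗ π) ⊗ u
    u≈tπu = begin
      u
        ≈⟨ ⊗-identityˡ u ⟨
      𝟏 ⊗ u
        ≈⟨ ⊗-congʳ 1≈ ⟩
      (y ⊗ x ⊕ t ⊗ π) ⊗ u
        ≈⟨ solve 5 (λ y x t π u → (y :* x :+ t :* π) :* u :=
             y :* (x :* u) :+ (t :* π) :* u) ≈-refl y x t π u ⟩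
      y ⊗ (x ⊗ u) ⊕ (t ⊗ π) ⊗ u
        ≈⟨ ⊕-congʳ (≈-trans (⊗-congˡ xu≈0) (⊗-zeroʳ y)) ⟩
      𝟘 ⊕ (t ⊗ π) ⊗ u
        ≈⟨ ⊕-identityˡ _ ⟩
      (t ⊗ π) ⊗ u ∎

    divisible : ∀ k → ∃[ v ] u ≈ v ⊗ π ^ᴿ k
    divisible zero    = u , ≈-sym (≈-trans (⊗-comm u 𝟏) (⊗-identityˡ u))
    divisible (suc k) with v , u≈ ← divisible k = t ⊗ v , (begin
      u
        ≈⟨ u≈tπu ⟩
      (t ⊗ π) ⊗ u
        ≈⟨ ⊗-congˡ u≈ ⟩
      (t ⊗ π) ⊗ (v ⊗ π ^ᴿ k)
        ≈⟨ solve 4 (λ t π v p → (t :* π) :* (v :* p) := (t :* v) :* (π :* p)) ≈-refl t π v (π ^ᴿ k) ⟩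
      (t ⊗ v) ⊗ (π ⊗ π ^ᴿ k) ∎)

  -- Multiply the relation z x + t π = 1 by y: both resulting summands lie in `𝔪`.
  prime : ∀ {x y} → ¬ (x ∋𝔪) → (x ⊗ y) ∋𝔪 → y ∋𝔪
  prime {x} {y} x∉𝔪 xy∈𝔪 with z , t , 1≈ ← bezout x x∉𝔪 =
    respects (begin
      z ⊗ (x ⊗ y) ⊕ (t ⊗ y) ⊗ π
        ≈⟨ solve 5 (λ z x y t π → z :* (x :* y) :+ (t :* y) :* π := (z :* x :+ t :* π) :* y) ≈-refl z x y t π ⟩
      (z ⊗ x ⊕ t ⊗ π) ⊗ y
        ≈⟨ ⊗-congʳ 1≈ ⟨
      𝟏 ⊗ y
        ≈⟨ ⊗-identityˡ y ⟩
      y ∎)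
    (+-closed (*-closed z xy∈𝔪) (*-closed (t ⊗ y) π∈𝔪))

  -- The residue field and its parity.

  private
    module 𝕜 = Setoid (quotient R isIdeal)
  open Inverse residueField using ()
    renaming (to to rep; from to class; from-cong to class-cong;
              inverseˡ to rep-classˡ; inverseʳ to class-repʳ)

  rep-class : ∀ x → (rep (class x) ⊝ x) ∋𝔪
  rep-class x = rep-classˡ refl

  class-rep : ∀ c → class (rep c) ≡ c
  class-rep c = class-repʳ 𝕜.refl

  class-injective : ∀ {x y} → class x ≡ class y → (x ⊝ y) ∋𝔪
  class-injective {x} {y} eq = 𝕜.trans (𝕜.sym (rep-class x))
    (subst (λ c → (rep c ⊝ y) ∋𝔪) (sym eq) (rep-class y))

  ⊝-intro : ∀ {x y z} → x ≈ y ⊕ z → z ∋𝔪 → (x ⊝ y) ∋𝔪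
  ⊝-intro {x} {y} {z} x≈ = respects (∙-cancelˡ y _ _ (≈-trans (≈-sym x≈) (≈-sym (⊕-⊝-cancel x y))))

  ⊝-+1-cong : ∀ {x y} → (x ⊝ y) ∋𝔪 → ((x ⊕ 𝟏) ⊝ (y ⊕ 𝟏)) ∋𝔪
  ⊝-+1-cong {x} {y} = ⊝-intro (begin
    x ⊕ 𝟏                  ≈⟨ ⊕-congʳ (⊕-⊝-cancel x y) ⟨
    (y ⊕ (x ⊝ y)) ⊕ 𝟏      ≈⟨ solve 3 (λ y d o → (y :+ d) :+ o := (y :+ o) :+ d) ≈-refl y (x ⊝ y) 𝟏 ⟩
    (y ⊕ 𝟏) ⊕ (x ⊝ y)      ∎)

  -- Equal classes would put the difference 1 into `𝔪`.
  class-suc≢ : ∀ {x} → class (x ⊕ 𝟏) ≢ class x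
  class-suc≢ {x} eq = proper (respects (∙-cancelˡ x _ _ (⊕-⊝-cancel (x ⊕ 𝟏) x)) (class-injective eq))

  -- If 2 ∈ 𝔪, then c ↦ c + 1 is an involution of the residue field without
  -- fixed points.
  2∉𝔪 : ¬ (2 ∣ q) → ¬ ((𝟏 ⊕ 𝟏) ∋𝔪)
  2∉𝔪 2∤q 2∈𝔪 = 2∤q (fixedPointFree-involution⇒2∣ σ σσ λ c eq → class-suc≢ (trans eq (sym (class-rep c))))
    where
    σ : Fin q → Fin q
    σ c = class (rep c ⊕ 𝟏)
    σσ : ∀ c → σ (σ c) ≡ c
    σσ c = trans (class-cong (𝕜.trans (⊝-+1-cong (rep-class (rep c ⊕ 𝟏)))
      (⊝-intro (⊕-assoc (rep c) 𝟏 𝟏) 2∈𝔪))) (class-rep c)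

  -- The classes of 0 and 1 are distinct, which excludes q ≤ 1, and parity excludes q = 2.
  3≤q : ¬ (2 ∣ q) → 3 ≤ q
  3≤q = lemma (class 𝟘) (class (𝟘 ⊕ 𝟏)) class-suc≢
    where
    lemma : ∀ {q} (c d : Fin q) → d ≢ c → ¬ (2 ∣ q) → 3 ≤ q
    lemma {1}                 zero zero d≢c _   = contradiction refl d≢c
    lemma {2}                 _    _    _   2∤q = contradiction ∣-refl 2∤q
    lemma {suc (suc (suc _))} _    _    _   _   = s≤s (s≤s (s≤s z≤n))

  -- Expansions in powers of the uniformiser and the order of the ring.

  -- The truncated π-adic expansion with k digits taken from the representatives `rep`. The index in
  -- `Fin (q ^ k)` encodes the digits, and its first component under `remQuot` is the constant term.
  horner : ∀ k → Fin (q ^ k) → Carrier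
  horner zero    _ = 𝟘
  horner (suc k) i = rep (proj₁ (remQuot {q} (q ^ k) i)) ⊕ π ⊗ horner k (proj₂ (remQuot {q} (q ^ k) i))

  -- Since π is nilpotent it cannot be cancelled; the induction instead collects the powers already
  -- split off in the factor π ^ j. If the constant digits differed, X ⊝ Y would be regular and π ^
  -- j would vanish.
  horner-injective : ∀ k j → (∀ m → m < j + k → ¬ (π ^ᴿ m ≈ 𝟘)) → ∀ {u v} →
                     π ^ᴿ j ⊗ horner k u ≈ π ^ᴿ j ⊗ horner k v → u ≡ v
  horner-injective zero    j _ {zero} {zero} _ = refl
  horner-injective (suc k) j π^m≉0 {u} {v} eq = trans (sym (combine-remQuot {q} (q ^ k) u))
    (trans (cong₂ combine d≡d′ e≡e′) (combine-remQuot {q} (q ^ k) v))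
    where
    d = proj₁ (remQuot {q} (q ^ k) u)
    e = proj₂ (remQuot {q} (q ^ k) u)
    d′ = proj₁ (remQuot {q} (q ^ k) v)
    e′ = proj₂ (remQuot {q} (q ^ k) v)
    X = rep d ⊕ π ⊗ horner k e
    Y = rep d′ ⊕ π ⊗ horner k e′

    leading : ∀ d e → class (rep d ⊕ π ⊗ horner k e) ≡ d
    leading d e = trans
      (class-cong (⊝-intro ≈-refl (respects (⊗-comm _ π) (*-closed (horner k e) π∈𝔪))))
      (class-rep d)

    π^j⊗[X⊝Y]≈0 : (X ⊝ Y) ⊗ π ^ᴿ j ≈ 𝟘
    π^j⊗[X⊝Y]≈0 = identityʳ-unique (π ^ᴿ j ⊗ Y) _ (begin
      π ^ᴿ j ⊗ Y ⊕ (X ⊝ Y) ⊗ π ^ᴿ j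
        ≈⟨ solve 3 (λ p y z → p :* y :+ z :* p := p :* (y :+ z)) ≈-refl (π ^ᴿ j) Y (X ⊝ Y) ⟩
      π ^ᴿ j ⊗ (Y ⊕ (X ⊝ Y))          ≈⟨ ⊗-congˡ (⊕-⊝-cancel X Y) ⟩
      π ^ᴿ j ⊗ X                      ≈⟨ eq ⟩
      π ^ᴿ j ⊗ Y                      ∎)

    d≡d′ : d ≡ d′
    d≡d′ with index (X ⊝ Y) ∈? 𝔪
    ... | yes X∼Y = trans (sym (leading d e)) (trans (class-cong X∼Y) (leading d′ e′))
    ... | no  X≁Y = contradiction (regular X≁Y π^j⊗[X⊝Y]≈0) (π^m≉0 j (m<m+n j (s≤s z≤n)))

    e≡e′ : e ≡ e′
    e≡e′ = horner-injective k (suc j) (λ m m< → π^m≉0 m (subst (m <_) (sym (+-suc j k)) m<))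
      (∙-cancelˡ (π ^ᴿ j ⊗ rep d′) _ _ (begin
        π ^ᴿ j ⊗ rep d′ ⊕ (π ⊗ π ^ᴿ j) ⊗ horner k e
          ≈⟨ solve 4 (λ p d π h → p :* d :+ (π :* p) :* h := p :* (d :+ π :* h))
               ≈-refl (π ^ᴿ j) (rep d′) π (horner k e) ⟩
        π ^ᴿ j ⊗ (rep d′ ⊕ π ⊗ horner k e)
          ≡⟨ cong (λ c → π ^ᴿ j ⊗ (rep c ⊕ π ⊗ horner k e)) d≡d′ ⟨
        π ^ᴿ j ⊗ X
          ≈⟨ eq ⟩
        π ^ᴿ j ⊗ Y
          ≈⟨ solve 4 (λ p d π h → p :* d :+ (π :* p) :* h := p :* (d :+ π :* h))
               ≈-refl (π ^ᴿ j) (rep d′) π (horner k e′) ⟨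
        π ^ᴿ j ⊗ rep d′ ⊕ (π ⊗ π ^ᴿ j) ⊗ horner k e′ ∎))

  -- The difference of x and its representative is a multiple t π, and the expansion of t supplies
  -- the remaining digits.
  horner-surjective : ∀ k x → ∃[ u ] ∃[ y ] x ≈ horner k u ⊕ π ^ᴿ k ⊗ y
  horner-surjective zero    x = zero , x , ≈-sym (≈-trans (⊕-identityˡ _) (⊗-identityˡ x))
  horner-surjective (suc k) x
    with t , x≈ ← 𝔪⇒multiple (𝕜.sym (rep-class x))
    with e , y , t≈ ← horner-surjective k t = combine (class x) e , y , (begin
      x
        ≈⟨ ⊕-⊝-cancel x (rep (class x)) ⟨
      rep (class x) ⊕ (x ⊝ rep (class x))
        ≈⟨ ⊕-congˡ (≈-trans x≈ (⊗-congʳ t≈)) ⟩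
      rep (class x) ⊕ (horner k e ⊕ π ^ᴿ k ⊗ y) ⊗ π
        ≈⟨ solve 5 (λ c h p y π → c :+ (h :+ p :* y) :* π :=
             (c :+ π :* h) :+ (π :* p) :* y) ≈-refl (rep (class x)) (horner k e) (π ^ᴿ k) y π ⟩
      (rep (class x) ⊕ π ⊗ horner k e) ⊕ (π ⊗ π ^ᴿ k) ⊗ y
        ≡⟨ cong (λ (c , e) → (rep c ⊕ π ⊗ horner k e) ⊕ (π ⊗ π ^ᴿ k) ⊗ y) (remQuot-combine {q} (class x) e) ⟨
      horner (suc k) (combine (class x) e) ⊕ (π ⊗ π ^ᴿ k) ⊗ y ∎)

  -- For k = r the remainder of the expansion vanishes because π ^ r = 0, so digits determine
  -- elements; elements determine digits because the lower powers of π are nonzero. This gives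
  -- injections in both directions.
  size≡q^r : size ≡ q ^ r
  size≡q^r = ≤-antisym (injective⇒≤ digits-injective) (injective⇒≤ value-injective)
    where
    digits : Fin size → Fin (q ^ r)
    digits i = proj₁ (horner-surjective r (element i))

    horner-digits : ∀ i → element i ≈ horner r (digits i)
    horner-digits i with u , y , eq ← horner-surjective r (element i) =
      ≈-trans eq (≈-trans (⊕-congˡ (≈-trans (⊗-congʳ π^r≈0) (⊗-zeroˡ y))) (⊕-identityʳ _))

    digits-injective : Injective _≡_ _≡_ digits
    digits-injective {i} {j} eq = element-injective (≈-trans (horner-digits i)
      (≈-trans (reflexive (cong (horner r) eq)) (≈-sym (horner-digits j))))

    value-injective : Injective _≡_ _≡_ (index ∘ horner r)
    value-injective eq = horner-injective r 0 (λ _ → π^k≉0) (⊗-congˡ (index-injective eq))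

-- The order of the maximal ideal.

module _ {R : FiniteCommutativeRing a ℓ} {q r : ℕ} (V : IsValuationRing R q r) where
  open FiniteCommutativeRing R
    using (size; element; index; from-cong; +-congˡ; +-group)
    renaming (trans to ≈-trans; _+_ to infixl 6 _⊕_; _-_ to infixl 6 _⊝_)
  open FiniteRing R
  open ValuationRing V
  open Inverse residueField using () renaming (to to rep; from to class; from-cong to class-cong)
  open GroupProperties +-group using (∙-cancelˡ)

  -- The ring is the disjoint union of the q residue classes, each of them a translate of `𝔪`.
  size≡q*∣𝔪∣ : size ≡ q * ∣ 𝔪 ∣
  size≡q*∣𝔪∣ = begin
    size
      ≡⟨ sym (trans (∑-const size 1) (*-identityʳ size)) ⟩
    ∑[ i < size ] 1
      ≡⟨ sum-cong-≗ {size} (λ i → sym (∑-⟦≟⟧ (class (element i)))) ⟩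
    ∑[ i < size ] ∑[ c < q ] ⟦ class (element i) ≟ c ⟧
      ≡⟨ ∑-comm (λ i c → ⟦ class (element i) ≟ c ⟧) ⟩
    ∑[ c < q ] ∑[ i < size ] ⟦ class (element i) ≟ c ⟧
      ≡⟨ sum-cong-≗ {q} (λ c → sum-cong-≗ {size} λ i → coset c i) ⟩
    ∑[ c < q ] ∑[ i < size ] 𝟙 𝔪 (index (element i ⊝ rep c))
      ≡⟨ sum-cong-≗ {q} (λ c → translate (rep c)) ⟩
    ∑[ c < q ] ∣ 𝔪 ∣
      ≡⟨ ∑-const q ∣ 𝔪 ∣ ⟩
    q * ∣ 𝔪 ∣ ∎
    where
    open ≡-Reasoning
    coset : ∀ c i → ⟦ class (element i) ≟ c ⟧ ≡ 𝟙 𝔪 (index (element i ⊝ rep c))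
    coset c i = ≤-antisym
      (⟦⟧-mono (class (element i) ≟ c) (index (element i ⊝ rep c) ∈? 𝔪)
        λ eq → class-injective (trans eq (sym (class-rep c))))
      (⟦⟧-mono (index (element i ⊝ rep c) ∈? 𝔪) (class (element i) ≟ c)
        λ i∼c → trans (class-cong i∼c) (class-rep c))

    translate : ∀ x → ∑[ i < size ] 𝟙 𝔪 (index (element i ⊝ x)) ≡ ∣ 𝔪 ∣
    translate x = trans
      (∑-bijective (λ i → index (element i ⊝ x)) (λ i → index (x ⊕ element i)) (𝟙 𝔪)
        (λ i → trans (from-cong (∙-cancelˡ x _ _ (≈-trans (⊕-⊝-cancel _ x) (element-index _))))
          (index-element i))
        (λ i → trans (from-cong (≈-trans (+-congˡ (element-index _)) (⊕-⊝-cancel (element i) x)))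
          (index-element i)))
      (sym (∣p∣≡∑𝟙 𝔪))

∈⇒∣p∣≢0 : ∀ {p : Subset n} {i} → i ∈ p → NonZero ∣ p ∣
∈⇒∣p∣≢0 {p = p} {i} i∈p = >-nonZero (≤-trans (≤-reflexive (sym (⟦⟧-yes (i ∈? p) i∈p)))
  (≤-trans (term≤∑ (𝟙 p) i) (≤-reflexive (sym (∣p∣≡∑𝟙 p)))))

-- Multiplication by q raises the exponent from 3 r - 1 to 3 r; with truncated subtraction this
-- relies on r ≥ 1.
q^[3r∸1]<m⇒Q³≤mq : ∀ q r {Q m} → Q ≡ q ^ r → r ≢ 0 → q ^ (3 * r ∸ 1) < m → Q * Q * Q ≤ m * q
q^[3r∸1]<m⇒Q³≤mq q zero        _    0≢0 _  = contradiction refl 0≢0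
q^[3r∸1]<m⇒Q³≤mq q (suc r) {m = m} refl _ lt = begin
  q ^ suc r * q ^ suc r * q ^ suc r      ≡⟨ cube (q ^ suc r) ⟩
  (q ^ suc r) ^ 3                        ≡⟨ ^-*-assoc q (suc r) 3 ⟩
  q ^ (suc r * 3)                        ≡⟨ cong (q ^_) (*-comm (suc r) 3) ⟩
  -- Since `3 * suc r` reduces to a successor, this agrees with `q ^ (3 * suc r)` by computation.
  q * q ^ (3 * suc r ∸ 1)                ≤⟨ *-monoʳ-≤ q (<⇒≤ lt) ⟩
  q * m                                  ≡⟨ *-comm q m ⟩
  m * q                                  ∎
  where
  open ≤-Reasoning
  cube : ∀ x → x * x * x ≡ x * (x * (x * 1))
  cube = solve-∀

-- The estimate for a given set.

module _ {R : FiniteCommutativeRing a ℓ} {q r : ℕ} (V : IsValuationRing R q r) (2∤q : ¬ (2 ∣ q))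
         (A : Subset (FiniteCommutativeRing.size R)) (A-nonempty : Nonempty A)
         (large : ∣ sumset R A A ∣ * ∣ A ∣ ^ 2 > q ^ (3 * r ∸ 1)) where
  open FiniteCommutativeRing R using (size; element; index; from-cong)
    renaming (refl to ≈-refl; +-cong to ⊕-cong)
  open FiniteRing R
  open ValuationRing V

  private
    module F = IsCommutativeRing finIsCommutativeRing

    to-𝔪 : ∀ {i} → index (element i) ∈ 𝔪 → i ∈ 𝔪
    to-𝔪 = subst (_∈ 𝔪) (index-element _)

    from-𝔪 : ∀ {i} → i ∈ 𝔪 → index (element i) ∈ 𝔪
    from-𝔪 = subst (_∈ 𝔪) (sym (index-element _))

  open LocalRing finIsCommutativeRing 𝔪
    (λ x∈𝔪 y∈𝔪 → IsIdeal.+-closed isIdeal (from-𝔪 x∈𝔪) (from-𝔪 y∈𝔪))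
    (λ x∉𝔪 xy∈𝔪 → to-𝔪 (prime (λ x∈𝔪 → x∉𝔪 (to-𝔪 x∈𝔪)) xy∈𝔪))
    (λ x∉𝔪 xy≡0 → trans (sym (index-element _))
      (from-cong (regular (λ x∈𝔪 → x∉𝔪 (to-𝔪 x∈𝔪)) (index-injective xy≡0))))
    (λ 2∈𝔪 → 2∉𝔪 2∤q (subst (_∈ 𝔪) (from-cong (⊕-cong (element-index _) (element-index _))) 2∈𝔪))

  open Incidences F.+-isAbelianGroup using (incidence-bound; ⊕-⊖-cancel; ∣B∣≤∣B+c∣)

  private
    B K S : Subset size
    B = squares R A
    K = sumset R A A
    S = sumset R B B

    N T : ℕ
    N = ∣ A ∣
    T = ∣ B ∣

    sum∈ : ∀ X Y {i j} → i ∈ X → j ∈ Y → fin+ i j ∈ sumset R X Y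
    sum∈ X Y {i} {j} i∈X j∈Y = Equivalence.from (∋-sumset R X Y _)
      (element i , element j ,
       subst (_∈ X) (sym (index-element i)) i∈X , subst (_∈ Y) (sym (index-element j)) j∈Y , ≈-refl)

    square∈ : ∀ {i} → i ∈ A → fin* i i ∈ B
    square∈ {i} i∈A = Equivalence.from (∋-squares R A _)
      (element i , subst (_∈ A) (sym (index-element i)) i∈A , ≈-refl)

    -- Adding the square of one fixed element of `A` embeds `B` into `S`.
    T≤S : T ≤ ∣ S ∣
    T≤S = let i , i∈A = A-nonempty in ∣B∣≤∣B+c∣ B S (fin* i i) λ s∈B → sum∈ B B s∈B (square∈ i∈A)

    instance
      N≢0 : NonZero N
      N≢0 = let i , i∈A = A-nonempty in ∈⇒∣p∣≢0 i∈A

      T≢0 : NonZero T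
      T≢0 = let i , i∈A = A-nonempty in ∈⇒∣p∣≢0 (square∈ i∈A)

      K≢0 : NonZero ∣ K ∣
      K≢0 = let i , i∈A = A-nonempty in ∈⇒∣p∣≢0 (sum∈ A A i∈A i∈A)

      S≢0 : NonZero ∣ S ∣
      S≢0 = let i , i∈A = A-nonempty in ∈⇒∣p∣≢0 (sum∈ B B (square∈ i∈A) (square∈ i∈A))

      M≢0 : NonZero ∣ 𝔪 ∣
      M≢0 = ∈⇒∣p∣≢0 (IsIdeal.0-closed isIdeal)

      q≢0 : NonZero q
      q≢0 = >-nonZero (≤-trans (s≤s z≤n) (3≤q 2∤q))

      size≢0 : NonZero size
      size≢0 = >-nonZero (≤-trans (>-nonZero⁻¹ N) (∣p∣≤n A))

    -- The order of the ring is kept as a variable so that `size` can later be replaced by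
    -- `q * ∣ 𝔪 ∣`.
    IncidenceBound : ℕ → Set
    IncidenceBound n = n * (N * N) * (N * T) ≤
      ∣ K ∣ * ∣ S ∣ * (n * n) * ∣ 𝔪 ∣ + 2 * (∣ K ∣ * ∣ S ∣) * N * (N * T)

    parabolas-bound : IncidenceBound size
    parabolas-bound = incidence-bound parabola 𝔪 A B parabola-transversal K S
      (λ a∈A c∈A → sum∈ A A c∈A a∈A)
      -- At the abscissa c + a the parabola with vertex a has the value c², so the ordinate s + c²
      -- is a sum of two elements of `B`.
      (λ {a} {c} {s} _ c∈A s∈B → subst (λ z → fin+ s (fin* z z) ∈ S) (sym (⊕-⊖-cancel c a))
        (sum∈ B B s∈B (square∈ c∈A)))

    Q³≤KN²q : q * ∣ 𝔪 ∣ * (q * ∣ 𝔪 ∣) * (q * ∣ 𝔪 ∣) ≤ ∣ K ∣ * (N * N) * q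
    Q³≤KN²q = q^[3r∸1]<m⇒Q³≤mq q r (trans (sym (size≡q*∣𝔪∣ V)) size≡q^r) r≢0
      (subst (λ x → q ^ (3 * r ∸ 1) < ∣ K ∣ * (N * x)) (*-identityʳ N) large)

    ≤q*∣𝔪∣ : ∀ (X : Subset size) → ∣ X ∣ ≤ q * ∣ 𝔪 ∣
    ≤q*∣𝔪∣ X = subst (∣ X ∣ ≤_) (size≡q*∣𝔪∣ V) (∣p∣≤n X)

    N≤6T : N ≤ 6 * T
    N≤6T = many-squares (∣ 𝔪 ∣) N T
      (few-nonunits q (∣ 𝔪 ∣) N (∣ K ∣) Q³≤KN²q (3≤q 2∤q) (≤q*∣𝔪∣ K))
      (∣A∣≤∣𝔪∣+2∣A²∣ A B square∈)

  -- The estimate is squared, which clears the exponents r / 2 and 3 / 2.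
  sum-of-squares-bound : q ^ r * N ^ 3 ≤ (12 * (∣ S ∣ * ∣ K ∣)) ^ 2
  sum-of-squares-bound = begin
    q ^ r * N ^ 3
      ≡⟨ cong₂ _*_ (trans (sym size≡q^r) (size≡q*∣𝔪∣ V)) (cube N) ⟩
    q * ∣ 𝔪 ∣ * (N * N * N)
      ≤⟨ optimise q (∣ 𝔪 ∣) N T (∣ K ∣) (∣ S ∣) Q³≤KN²q N≤6T T≤S (≤q*∣𝔪∣ A)
           (subst IncidenceBound (size≡q*∣𝔪∣ V) parabolas-bound) ⟩
    12 * (∣ K ∣ * ∣ S ∣) * (12 * (∣ K ∣ * ∣ S ∣))
      ≡⟨ cong (λ W → 12 * W * (12 * W)) (*-comm ∣ K ∣ ∣ S ∣) ⟩
    12 * (∣ S ∣ * ∣ K ∣) * (12 * (∣ S ∣ * ∣ K ∣))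
      ≡⟨ cong (12 * (∣ S ∣ * ∣ K ∣) *_) (*-identityʳ (12 * (∣ S ∣ * ∣ K ∣))) ⟨
    (12 * (∣ S ∣ * ∣ K ∣)) ^ 2 ∎
    where
    open ≤-Reasoning
    cube : ∀ x → x * (x * (x * 1)) ≡ x * x * x
    cube = solve-∀

theorem1p2 : ∀ (a ℓ : Level) →
    ∃[ c ] (0 < c ×
    (∀ (R : FiniteCommutativeRing a ℓ) (q r : ℕ) →
    IsValuationRing R q r →
    ¬ (2 ∣ q) →
    (A : Subset (FiniteCommutativeRing.size R)) → Nonempty A →
    ∣ sumset R A A ∣ * ∣ A ∣ ^ 2 > q ^ (3 * r ∸ 1) →
    q ^ r * ∣ A ∣ ^ 3 ≤
    (c * (∣ sumset R (squares R A) (squares R A) ∣ * ∣ sumset R A A ∣)) ^ 2))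
-- The constant is 2 · 6: a factor 2 from keeping the larger of two summands and a factor 6 from |A|
-- ≤ 6 |A²|.
theorem1p2 a ℓ = 12 , z<s , λ R q r V 2∤q A A-nonempty large → sum-of-squares-bound V 2∤q A A-nonempty large
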